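{- Let $\Gamma$ be a group and let $F$ be a $\Gamma$-species with $\Gamma$-cycle index series $Z^{\Gamma}_{F}$. Fix a vector $\pi=\langle \pi_1,\dots,\pi_k\rangle$ of positive integers with $\pi_1+\dots+\pi_k=n$, and let $\gamma\in\Gamma$. Then the number of partially-labeled $F$-structures of profile $\pi$ which are fixed by the action of $\gamma$ is equal to the coefficient of $x_\pi=x_1^{\pi_1}x_2^{\pi_2}\cdots x_k^{\pi_k}$ in $\eta\bigl(Z^{\Gamma}_{F}(\gamma)\bigr)$.
   Context: A (combinatorial) species $F$ assigns to each finite set $A$ a finite set $F[A]$ ("$F$-structures labeled by $A$") and to each bijection $\sigma:A\to B$ a bijection $F[\sigma]:F[A]\to F[B]$, functorially ($F[\mathrm{id}]=\mathrm{id}$, $F[\tau\circ\sigma]=F[\tau]\circ F[\sigma]$). A $\Gamma$-species is a species $F$ together with, for each $\gamma\in\Gamma$ and each finite set $A$, a permutation $\gamma_A$ of $F[A]$, such that $\gamma\mapsto\gamma_A$ is a group action of $\Gamma$ on $F[A]$ and $\gamma_B\circ F[\sigma]=F[\sigma]\circ\gamma_A$ for every bijection $\sigma:A\to B$. Write $[n]=\{1,\dots,n\}$ and $\mathfrak S_n$ for the symmetric group on $[n]$. Let $\Lambda$ be the ring of symmetric functions with power-sum basis $p_1,p_2,\dots$; for $\sigma\in\mathfrak S_n$ put $p_\sigma=p_1^{\sigma_1}p_2^{\sigma_2}\cdots$ where $\sigma_i$ is the number of $i$-cycles of $\sigma$. The $\Gamma$-cycle index series of $F$ assigns to each $\gamma\in\Gamma$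 the series $Z^{\Gamma}_{F}(\gamma)=\sum_{n\ge0}\frac{1}{n!}\sum_{\sigma\in\mathfrak S_n}\mathrm{fix}\bigl(\gamma_{[n]}\cdot F[\sigma]\bigr)\,p_\sigma$, where $\mathrm{fix}(\gamma_{[n]}\cdot F[\sigma])$ is the number of $T\in F[[n]]$ with $\gamma_{[n]}(F[\sigma](T))=T$. Let $\eta$ be the map sending each symmetric function to its expansion as a formal power series in the variables $x_1,x_2,\dots$ (so $\eta(p_i)=\sum_j x_j^i$). Partially-labeled structures: a coloring is a map $c:[n]\to\{1,2,3,\dots\}$; $\mathfrak S_n$ acts on colorings by $(\sigma\cdot c)(i)=c(\sigma^{ -1}(i))$ and on $F[[n]]\times\{\text{colorings}\}$ diagonally (via $F[\sigma]$ on the first factor). For the profile $\pi$, let $c_\pi$ be the coloring sending the first $\pi_1$ elements of $[n]$ to $1$, the next $\pi_2$ to $2$, and so on. A partially-labeled $F$-structure of profile $\pi$ is an $\mathfrak S_n$-orbit of a pair $(T,c_\pi)$ with $T\in F[[n]]$. The element $\gamma$ acts on such pairs by $(T,c)\mapsto(\gamma_{[n]}(T),c)$; this commutes with the $\mathfrak S_n$-action and so acts on partially-labeled structures, and "fixed by $\gamma$" refers to this induced action on orbits. -}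

module Defs where

open import Level using (Level; _⊔_)
open import Data.Bool.Base using (Bool; true; false; if_then_else_; _∧_; _∨_; not)
open import Data.Nat.Base as ℕ using (ℕ; zero; suc; _∸_; _!)
open import Data.Nat.Properties using (_!≢0)
import Data.Nat.Properties as ℕP
open import Data.Fin.Base using (Fin; zero; suc; toℕ)
open import Data.Fin.Properties using (_≟_; all?)
open import Data.Vec.Base as Vec using (Vec; []; _∷_; lookup; tabulate)
open import Data.List.Base as List using (List; []; _∷_; [_]; map; concatMap; mapMaybe; upTo; allFin)
open import Data.Maybe.Base using (Maybe; just; nothing)
open import Data.Product.Base using (Σ; _,_; proj₁)
open import Data.Integer.Base using (+_)
open import Data.Rational.Base as ℚ using (ℚ; 0ℚ; 1ℚ; _/_)
open import Relation.Nullary.Decidable using (Dec; yes; no; True; ⌊_⌋; fromWitness; _→-dec_)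
open import Relation.Binary.PropositionalEquality using (_≡_)
open import Algebra.Bundles using (Group)

count : {A : Set} → (A → Bool) → List A → ℕ
count p []       = 0
count p (x ∷ xs) = if p x then suc (count p xs) else count p xs

anyᵇ : {A : Set} → (A → Bool) → List A → Bool
anyᵇ p []       = false
anyᵇ p (x ∷ xs) = if p x then true else anyᵇ p xs

allᵇ : {A : Set} → (A → Bool) → List A → Bool
allᵇ p []       = true
allᵇ p (x ∷ xs) = p x ∧ allᵇ p xs

sumℚ : List ℚ → ℚ
sumℚ = List.foldr ℚ._+_ 0ℚ

toℚ : ℕ → ℚ
toℚ m = (+ m) / 1

allVec : (m n : ℕ) → List (Vec (Fin m) n)
allVec m zero    = [ [] ]
allVec m (suc n) = concatMap (λ x → map (x ∷_) (allVec m n)) (allFin m)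

-- The symmetric group 𝔖ₙ: permutations of [n] ≅ Fin n, stored as the
-- vector of values (σ(1),…,σ(n)), with a (proof-irrelevant) certificate
-- that the map is injective (hence bijective, [n] being finite).

IsPerm : {n : ℕ} → Vec (Fin n) n → Set
IsPerm {n} v = ∀ (i j : Fin n) → lookup v i ≡ lookup v j → i ≡ j

isPerm? : {n : ℕ} → (v : Vec (Fin n) n) → Dec (IsPerm v)
isPerm? v = all? (λ i → all? (λ j → (lookup v i ≟ lookup v j) →-dec (i ≟ j)))

Perm : ℕ → Set
Perm n = Σ (Vec (Fin n) n) (λ v → True (isPerm? v))

_⟨$⟩_ : {n : ℕ} → Perm n → Fin n → Fin n
σ ⟨$⟩ i = lookup (proj₁ σ) i

toPerm : {n : ℕ} → Vec (Fin n) n → Maybe (Perm n)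
toPerm v with isPerm? v
... | yes p = just (v , fromWitness p)
... | no _  = nothing

allPerms : (n : ℕ) → List (Perm n)
allPerms n = mapMaybe toPerm (allVec n n)

-- Species (restricted to the skeleton {[n]}: F[[n]] is a finite set,
-- taken to be Fin (size n)), and Γ-species.

record Species : Set where
  field
    size : ℕ → ℕ
    tr   : {n : ℕ} → Perm n → Fin (size n) → Fin (size n)
    tr-id : {n : ℕ} (ρ : Perm n) → (∀ i → ρ ⟨$⟩ i ≡ i) →
            ∀ x → tr ρ x ≡ x
    tr-∘  : {n : ℕ} (σ τ ρ : Perm n) → (∀ i → ρ ⟨$⟩ i ≡ τ ⟨$⟩ (σ ⟨$⟩ i)) →
            ∀ x → tr ρ x ≡ tr τ (tr σ x)

record ΓSpecies {c ℓ : Level} (Γ : Group c ℓ) : Set (c ⊔ ℓ) where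
  open Group Γ using (Carrier; _≈_; _∙_; ε)
  field
    species : Species
  open Species species public
  field
    act   : {n : ℕ} → Carrier → Fin (size n) → Fin (size n)
    act-ε : {n : ℕ} (x : Fin (size n)) → act ε x ≡ x
    act-∙ : {n : ℕ} (g h : Carrier) (x : Fin (size n)) →
            act (g ∙ h) x ≡ act g (act h x)
    act-≈ : {n : ℕ} (g h : Carrier) → g ≈ h → (x : Fin (size n)) →
            act g x ≡ act h x
    act-tr : {n : ℕ} (g : Carrier) (σ : Perm n) (x : Fin (size n)) →
             act g (tr σ x) ≡ tr σ (act g x)

-- Polynomials in the variables x₁,…,x_k with rational coefficients,
-- represented by their coefficient function on exponent vectors.

Poly : ℕ → Set
Poly k = Vec ℕ k → ℚ

_≡ᵛ_ : {k : ℕ} → Vec ℕ k → Vec ℕ k → Bool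
[]      ≡ᵛ []      = true
(a ∷ α) ≡ᵛ (b ∷ β) = ⌊ a ℕP.≟ b ⌋ ∧ (α ≡ᵛ β)

mono : {k : ℕ} → Vec ℕ k → Poly k
mono β α = if α ≡ᵛ β then 1ℚ else 0ℚ

_⊕_ : {k : ℕ} → Poly k → Poly k → Poly k
(f ⊕ g) α = f α ℚ.+ g α

_•_ : {k : ℕ} → ℚ → Poly k → Poly k
(q • f) α = q ℚ.* f α

sumP : {k : ℕ} → List (Poly k) → Poly k
sumP []       α = 0ℚ
sumP (f ∷ fs) α = f α ℚ.+ sumP fs α

below : {k : ℕ} → Vec ℕ k → List (Vec ℕ k)
below []      = [ [] ]
below (a ∷ α) = concatMap (λ b → map (b ∷_) (below α)) (upTo (suc a))

_∸ᵛ_ : {k : ℕ} → Vec ℕ k → Vec ℕ k → Vec ℕ k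
α ∸ᵛ β = Vec.zipWith _∸_ α β

_⊗_ : {k : ℕ} → Poly k → Poly k → Poly k
(f ⊗ g) α = sumℚ (map (λ β → f β ℚ.* g (α ∸ᵛ β)) (below α))

oneP : {k : ℕ} → Poly k
oneP = mono (Vec.replicate _ 0)

_^P_ : {k : ℕ} → Poly k → ℕ → Poly k
f ^P zero  = oneP
f ^P suc m = f ⊗ (f ^P m)

-- η(p_m) restricted to x₁,…,x_k :  x₁^m + ⋯ + x_k^m
powerSum : (k m : ℕ) → Poly k
powerSum k m = sumP (map (λ j → mono (tabulate (λ i → if ⌊ i ≟ j ⌋ then m else 0)))
                         (allFin k))

cycleLength : {n : ℕ} → Perm n → Fin n → ℕ
cycleLength {n} σ i = go n 1 (σ ⟨$⟩ i)
  where
  go : ℕ → ℕ → Fin n → ℕ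
  go zero    m x = m
  go (suc f) m x = if ⌊ x ≟ i ⌋ then m else go f (suc m) (σ ⟨$⟩ x)

numCycles : {n : ℕ} → Perm n → ℕ → ℕ
numCycles {n} σ zero    = 0
numCycles {n} σ (suc m) =
  count (λ i → ⌊ cycleLength σ i ℕP.≟ suc m ⌋) (allFin n) ℕ./ suc m

pσ : (k : ℕ) {n : ℕ} → Perm n → Poly k
pσ k {n} σ = List.foldr (λ m f → (powerSum k m ^P numCycles σ m) ⊗ f) oneP
                        (List.map suc (upTo n))

module _ {c ℓ : Level} {Γ : Group c ℓ} (F : ΓSpecies Γ) where
  open ΓSpecies F
  open Group Γ using (Carrier)

  fixCount : {n : ℕ} → Carrier → Perm n → ℕ
  fixCount {n} γ σ = count (λ T → ⌊ act γ (tr σ T) ≟ T ⌋) (allFin (size n))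

  ηZdeg : (k : ℕ) → Carrier → ℕ → Poly k
  ηZdeg k γ N =
    ((+ 1 / (N !)) {{N !≢0}}) •
      sumP (map (λ σ → toℚ (fixCount γ σ) • pσ k σ) (allPerms N))

  -- coefficient of x^α in η(Z^Γ_F(γ)) = Σ_N coefficient of x^α in η(Z_N);
  -- only N ≤ |α| can contribute (η(Z_N) is homogeneous of degree N)
  coeffηZ : {k : ℕ} → Carrier → Vec ℕ k → ℚ
  coeffηZ {k} γ α =
    sumℚ (map (λ N → ηZdeg k γ N α) (upTo (suc (Vec.sum α))))

-- c_π : [n] → {1,2,…}, position m (0-based) ↦ its block number (1-based)
blockOf : {k : ℕ} → Vec ℕ k → ℕ → ℕ
blockOf []      m = 0
blockOf (a ∷ π) m = if ⌊ m ℕP.<? a ⌋ then 1 else suc (blockOf π (m ∸ a))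

coloringOf : {k : ℕ} (π : Vec ℕ k) → Fin (Vec.sum π) → ℕ
coloringOf π i = blockOf π (toℕ i)

-- σ · c = c, where (σ · c)(i) = c(σ⁻¹(i)), i.e. (σ·c)(σ j) = c j
fixesColoring : {n : ℕ} → Perm n → (Fin n → ℕ) → Bool
fixesColoring {n} σ col =
  allᵇ (λ i → allᵇ (λ j →
     not ⌊ σ ⟨$⟩ j ≟ i ⌋ ∨ ⌊ col j ℕP.≟ col i ⌋ ) (allFin n)) (allFin n)

module _ {c ℓ : Level} {Γ : Group c ℓ} (F : ΓSpecies Γ) {k : ℕ} (π : Vec ℕ k) where
  open ΓSpecies F
  open Group Γ using (Carrier)

  private
    n = Vec.sum π

  -- (T , c_π) and (T' , c_π) lie in the same 𝔖ₙ-orbit: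
  -- ∃ σ ∈ 𝔖ₙ with (F[σ] T , σ · c_π) = (T' , c_π)
  sameOrbit : Fin (size n) → Fin (size n) → Bool
  sameOrbit T T' = anyᵇ (λ σ → fixesColoring σ (coloringOf π) ∧ ⌊ tr σ T ≟ T' ⌋)
                        (allPerms n)

  isCanonical : Fin (size n) → Bool
  isCanonical T = not (anyᵇ (λ T' → ⌊ toℕ T' ℕP.<? toℕ T ⌋ ∧ sameOrbit T' T)
                            (allFin (size n)))

  -- number of partially-labeled F-structures of profile π fixed by γ:
  -- orbits [(T , c_π)] (counted once each via their canonical
  -- representative T) with γ·[(T , c_π)] = [(γ T , c_π)] = [(T , c_π)]
  numFixedPL : Carrier → ℕ
  numFixedPL γ = count (λ T → isCanonical T ∧ sameOrbit T (act γ T))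
                       (allFin (size n))

{-# OPTIONS --safe #-}
-- Let H ≤ 𝔖ₙ be the stabilizer of c_π. Burnside's argument applied to H, twisted by γ,
-- gives Σ_{σ ∈ H} fix(γ F[σ]) = |H| · (number of γ-fixed orbits): for x, y in F[n] the number
-- of σ ∈ H carrying x to y depends only on the H-orbits, and vanishes unless these agree.
-- On the other side, the coefficient of x_π in p_σ is the number of σ-invariant colorings
-- with content π. Each such coloring is c_π ∘ τ⁻¹ for exactly |H| permutations τ, and it is
-- σ-invariant iff τ⁻¹στ ∈ H; since fix(γ F[σ]) is a class function of σ, summing over σ
-- gives n! · Σ_{ρ ∈ H} fix(γ F[ρ]) / |H|.
module Submission where

open import Defs
open import Level using (Level)
open import Algebra.Bundles using (Group)
open import Data.Bool.Base using (Bool; true; false; if_then_else_; T; _∧_; _∨_; not)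
import Data.Bool.Properties as Boolₚ
open import Data.Empty using (⊥-elim)
open import Data.Fin.Base as Fin using (Fin; zero; suc; toℕ; punchIn; punchOut; _↑ˡ_; _↑ʳ_; splitAt)
import Data.Fin.Properties as Finₚ
import Data.Integer.Base as ℤ
import Data.Integer.Properties as ℤₚ
open import Data.List.Base as List using (List; []; _∷_; [_]; map; concatMap; mapMaybe; allFin; length; _++_; upTo; applyUpTo; replicate)
import Data.List.Properties as Listₚ
open import Data.List.Membership.Propositional using (_∈_)
open import Data.List.Membership.Propositional.Properties using (∈-∃++)
open import Data.List.Relation.Binary.Permutation.Propositional as ↭ using (_↭_; prep; ↭-refl; ↭-sym; ↭-trans)
open import Data.List.Relation.Binary.Permutation.Propositional.Properties using (shift)
open import Data.List.Relation.Unary.Any using (here; there)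
open import Data.Maybe.Base using (Maybe; just; nothing; maybe′)
open import Data.Nat.Base using (ℕ; zero; suc; _+_; _*_; _∸_; _/_; _%_; _≤_; _<_; z≤n; s≤s; s≤s⁻¹; _!; NonZero; ≢-nonZero)
import Data.Nat.Coprimality as Coprimality
open import Data.Nat.DivMod using (m≡m%n+[m/n]*n; m%n<n; m*n/n≡m)
open import Data.Nat.Properties as ℕₚ hiding (_≟_)
open import Algebra.Properties.CommutativeSemigroup +-commutativeSemigroup using (interchange; x∙yz≈y∙xz)
open import Algebra.Properties.CommutativeSemigroup *-commutativeSemigroup using () renaming (interchange to *-interchange; x∙yz≈y∙xz to *-exchange)
open import Data.Product.Base using (∃; _×_; _,_; proj₁; proj₂)
open import Data.Product.Properties using () renaming (≡-dec to ×-≡-dec)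
open import Data.Rational.Base as ℚ using (ℚ; 0ℚ; 1ℚ; mkℚ)
import Data.Rational.Properties as ℚₚ
import Data.Rational.Unnormalised.Base as ℚᵘ
import Data.Rational.Unnormalised.Properties as ℚᵘₚ
open import Data.Sum.Base using (inj₁; inj₂; [_,_]′)
open import Data.Unit.Base using (tt)
open import Data.Vec.Base as Vec using (Vec; []; _∷_; lookup; tabulate)
import Data.Vec.Properties as Vecₚ
open import Function.Base using (_∘_; id; _$_)
open import Function.Bundles using (Equivalence)
open import Relation.Binary.Definitions using (DecidableEquality; tri<; tri≈; tri>)
open import Relation.Binary.PropositionalEquality hiding ([_])
open import Relation.Nullary.Decidable using (Dec; yes; no; does; ⌊_⌋; toWitness; fromWitness; map′; _×-dec_)
open import Relation.Nullary.Negation using (¬_)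

-- The product `pσ` is grouped by cycle length, with multiplicities obtained by dividing a number of
-- points, whereas invariant colorings see the individual cycles. The two are reconciled by reading
-- both as lists of cycle lengths in which every length has the same multiplicity: a product of
-- power sums depends on nothing else. To count invariant colorings by recursion on the points, each
-- cycle is represented by its greatest element, so the lowest point can always be removed without
-- depriving another point of its representative; its weight is passed on. All counting is done in
-- the naturals, with sums of decidable indicators. The order of H is never divided by: it appears
-- as a common nonzero factor and is cancelled, and only 1/n! is left to the rationals. Since
-- `coeffηZ` sums over all degrees up to n, those below n must be shown to vanish; this rests on the
-- fact that the content of a coloring of m points has total m.

private
  variable
    A B P Q : Set
    k n     : ℕ

-- Finite sums and enumerations

∑ : List A → (A → ℕ) → ℕ
∑ []       f = 0
∑ (x ∷ xs) f = f x + ∑ xs f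

∑-cong : (xs : List A) {f g : A → ℕ} → (∀ x → f x ≡ g x) → ∑ xs f ≡ ∑ xs g
∑-cong []       eq = refl
∑-cong (x ∷ xs) eq = cong₂ _+_ (eq x) (∑-cong xs eq)

∑-zero : (xs : List A) {f : A → ℕ} → (∀ x → f x ≡ 0) → ∑ xs f ≡ 0
∑-zero []       eq = refl
∑-zero (x ∷ xs) eq = cong₂ _+_ (eq x) (∑-zero xs eq)

∑-+ : (xs : List A) {f g : A → ℕ} → ∑ xs (λ x → f x + g x) ≡ ∑ xs f + ∑ xs g
∑-+ []               = refl
∑-+ (x ∷ xs) {f} {g} = trans (cong (f x + g x +_) (∑-+ xs)) (interchange (f x) (g x) _ _)

∑-*ˡ : (xs : List A) (a : ℕ) {f : A → ℕ} → ∑ xs (λ x → a * f x) ≡ a * ∑ xs f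
∑-*ˡ []       a     = sym (*-zeroʳ a)
∑-*ˡ (x ∷ xs) a {f} = trans (cong (a * f x +_) (∑-*ˡ xs a)) (sym (*-distribˡ-+ a (f x) _))

∑-*ʳ : (xs : List A) (a : ℕ) {f : A → ℕ} → ∑ xs (λ x → f x * a) ≡ ∑ xs f * a
∑-*ʳ xs a {f} = trans (∑-cong xs (λ x → *-comm (f x) a)) (trans (∑-*ˡ xs a) (*-comm a _))

∑-swap : (xs : List A) (ys : List B) {f : A → B → ℕ} →
         ∑ xs (λ x → ∑ ys (f x)) ≡ ∑ ys (λ y → ∑ xs (λ x → f x y))
∑-swap []       ys = sym (∑-zero ys (λ _ → refl))
∑-swap (x ∷ xs) ys = trans (cong (∑ ys _ +_) (∑-swap xs ys)) (sym (∑-+ ys))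

∑-map : (g : A → B) (xs : List A) {f : B → ℕ} → ∑ (map g xs) f ≡ ∑ xs (f ∘ g)
∑-map g []       = refl
∑-map g (x ∷ xs) = cong (_ +_) (∑-map g xs)

∑-++ : (xs ys : List A) {f : A → ℕ} → ∑ (xs ++ ys) f ≡ ∑ xs f + ∑ ys f
∑-++ []       ys     = refl
∑-++ (x ∷ xs) ys {f} = trans (cong (f x +_) (∑-++ xs ys)) (sym (+-assoc (f x) _ _))

∑-concatMap : (g : A → List B) (xs : List A) {f : B → ℕ} →
              ∑ (concatMap g xs) f ≡ ∑ xs (λ x → ∑ (g x) f)
∑-concatMap g []       = refl
∑-concatMap g (x ∷ xs) = trans (∑-++ (g x) _) (cong (_ +_) (∑-concatMap g xs))

∑-allFin-suc : ∀ n (f : Fin (suc n) → ℕ) →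
               ∑ (allFin (suc n)) f ≡ f zero + ∑ (allFin n) (f ∘ suc)
∑-allFin-suc n f = cong (f zero +_)
  (trans (cong (λ l → ∑ l f) (sym (Listₚ.map-tabulate id suc))) (∑-map suc (allFin n)))

𝟙 : Dec P → ℕ
𝟙 d = if does d then 1 else 0

𝟙-yes : (d : Dec P) → P → 𝟙 d ≡ 1
𝟙-yes (yes _) p = refl
𝟙-yes (no ¬p) p = ⊥-elim (¬p p)

𝟙-no : (d : Dec P) → ¬ P → 𝟙 d ≡ 0
𝟙-no (yes p) ¬p = ⊥-elim (¬p p)
𝟙-no (no _)  ¬p = refl

𝟙-⇔ : (d : Dec P) (e : Dec Q) → (P → Q) → (Q → P) → 𝟙 d ≡ 𝟙 e
𝟙-⇔ (yes p) e f g = sym (𝟙-yes e (f p))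
𝟙-⇔ (no ¬p) e f g = sym (𝟙-no e (¬p ∘ g))

𝟙-× : (d : Dec P) (e : Dec Q) → 𝟙 (d ×-dec e) ≡ 𝟙 d * 𝟙 e
𝟙-× (yes _) (yes _) = refl
𝟙-× (yes _) (no _)  = refl
𝟙-× (no _)  e       = refl

𝟙-guard : (d : Dec P) {a b : ℕ} → (P → a ≡ b) → 𝟙 d * a ≡ 𝟙 d * b
𝟙-guard (yes p) eq = cong (_+ 0) (eq p)
𝟙-guard (no _)  eq = refl

𝟙-vanish : (d : Dec P) {a : ℕ} → (P → a ≡ 0) → 𝟙 d * a ≡ 0
𝟙-vanish d eq = trans (𝟙-guard d eq) (*-zeroʳ (𝟙 d))

𝟙-absorb : (d : Dec P) {a : ℕ} → (¬ P → a ≡ 0) → 𝟙 d * a ≡ a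
𝟙-absorb (yes _) eq = *-identityˡ _
𝟙-absorb (no ¬p) eq = sym (eq ¬p)

T-dec : (b : Bool) → Dec (T b)
T-dec true  = yes tt
T-dec false = no id

count-∑ : (p : A → Bool) (xs : List A) → count p xs ≡ ∑ xs (λ x → 𝟙 (T-dec (p x)))
count-∑ p []       = refl
count-∑ p (x ∷ xs) with p x
... | true  = cong suc (count-∑ p xs)
... | false = count-∑ p xs

-- Multiplicity one is expressed as a sum of indicators rather than by membership and uniqueness, so
-- that it can be inserted into other sums and interchanged with them. Every reindexing below
-- reduces to `once`.
record Enum (A : Set) : Set where
  infix 4 _≟_
  field
    elems : List A
    _≟_   : DecidableEquality A
    once  : ∀ y → ∑ elems (λ x → 𝟙 (x ≟ y)) ≡ 1

  ∑-δ : ∀ y (f : A → ℕ) → ∑ elems (λ x → 𝟙 (x ≟ y) * f x) ≡ f y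
  ∑-δ y f = begin
    ∑ elems (λ x → 𝟙 (x ≟ y) * f x) ≡⟨ ∑-cong elems (λ x → 𝟙-guard (x ≟ y) (cong f)) ⟩
    ∑ elems (λ x → 𝟙 (x ≟ y) * f y) ≡⟨ ∑-*ʳ elems (f y) ⟩
    ∑ elems (λ x → 𝟙 (x ≟ y)) * f y ≡⟨ cong (_* f y) (once y) ⟩
    1 * f y                         ≡⟨ *-identityˡ (f y) ⟩
    f y                             ∎
    where open ≡-Reasoning

  ∑≡0⇒ : (f : A → ℕ) → ∑ elems f ≡ 0 → ∀ y → f y ≡ 0
  ∑≡0⇒ f eq y = trans (sym (∑-δ y f)) (go elems eq)
    where
    go : ∀ xs → ∑ xs f ≡ 0 → ∑ xs (λ x → 𝟙 (x ≟ y) * f x) ≡ 0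
    go []       eq = refl
    go (x ∷ xs) eq = cong₂ _+_
      (trans (cong (𝟙 (x ≟ y) *_) (m+n≡0⇒m≡0 (f x) eq)) (*-zeroʳ (𝟙 (x ≟ y))))
      (go xs (m+n≡0⇒n≡0 (f x) eq))

  T-any : (p : A → Bool) → ∀ {y} → T (p y) → T (anyᵇ p elems)
  T-any p {y} py = go elems (λ eq → 1+n≢0 (trans (sym (once y)) eq))
    where
    -- The nonvanishing sum stands for membership of `y` in the part of the list still to be
    -- searched.
    go : ∀ xs → ∑ xs (λ x → 𝟙 (x ≟ y)) ≢ 0 → T (anyᵇ p xs)
    go []       ne = ne refl
    go (x ∷ xs) ne with p x in eq | x ≟ y
    ... | true  | _        = tt
    ... | false | yes refl = ⊥-elim (subst T eq py)
    ... | false | no _     = go xs ne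

  all-T : (p : A → Bool) → T (allᵇ p elems) → ∀ y → T (p y)
  all-T p all y = go elems (λ eq → 1+n≢0 (trans (sym (once y)) eq)) all
    where
    go : ∀ xs → ∑ xs (λ x → 𝟙 (x ≟ y)) ≢ 0 → T (allᵇ p xs) → T (p y)
    go []       ne _ = ⊥-elim (ne refl)
    go (x ∷ xs) ne t with p x in eq | x ≟ y
    ... | true  | yes refl = subst T (sym eq) tt
    ... | true  | no _     = go xs ne t

any-T : (p : A → Bool) (xs : List A) → T (anyᵇ p xs) → ∃ λ x → T (p x)
any-T p (x ∷ xs) t with p x in eq
... | true  = x , subst T (sym eq) tt
... | false = any-T p xs t

T-all : (p : A → Bool) (xs : List A) → (∀ x → T (p x)) → T (allᵇ p xs)
T-all p []       t = tt
T-all p (x ∷ xs) t with p x | t x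
... | true | _ = T-all p xs t

-- Both sides weigh by `h y` the pairs `x`, `y` with `y ≡ f x`, and each coordinate of such a pair
-- determines the other. The order of the two lists is irrelevant.
∑-bij : (E : Enum A) (F : Enum B) (f : A → B) (g : B → A) →
        (∀ x → g (f x) ≡ x) → (∀ y → f (g y) ≡ y) →
        (h : B → ℕ) → ∑ (Enum.elems E) (h ∘ f) ≡ ∑ (Enum.elems F) h
∑-bij E F f g gf fg h = begin
  ∑ E.elems (λ x → h (f x))
    ≡⟨ ∑-cong E.elems (λ x → sym (F.∑-δ (f x) h)) ⟩
  ∑ E.elems (λ x → ∑ F.elems (λ y → 𝟙 (y F.≟ f x) * h y))
    ≡⟨ ∑-swap E.elems F.elems ⟩
  ∑ F.elems (λ y → ∑ E.elems (λ x → 𝟙 (y F.≟ f x) * h y))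
    ≡⟨ ∑-cong F.elems (λ y → ∑-cong E.elems (λ x → cong (_* h y)
         (𝟙-⇔ (y F.≟ f x) (x E.≟ g y) (λ { refl → sym (gf x) }) (λ { refl → sym (fg y) })))) ⟩
  ∑ F.elems (λ y → ∑ E.elems (λ x → 𝟙 (x E.≟ g y) * h y))
    ≡⟨ ∑-cong F.elems (λ y → E.∑-δ (g y) (λ _ → h y)) ⟩
  ∑ F.elems h ∎
  where
  open ≡-Reasoning
  module E = Enum E
  module F = Enum F

finEnum : ∀ n → Enum (Fin n)
finEnum n = record { elems = allFin n ; _≟_ = Finₚ._≟_ ; once = once n }
  where
  once : ∀ n (y : Fin n) → ∑ (allFin n) (λ x → 𝟙 (x Finₚ.≟ y)) ≡ 1
  once (suc n) zero    = trans (∑-allFin-suc n (λ x → 𝟙 (x Finₚ.≟ zero))) (cong suc (∑-zero (allFin n) (λ _ → refl)))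
  once (suc n) (suc y) = trans (∑-allFin-suc n (λ x → 𝟙 (x Finₚ.≟ suc y)))
    (trans (∑-cong (allFin n) (λ x → 𝟙-⇔ (suc x Finₚ.≟ suc y) (x Finₚ.≟ y) Finₚ.suc-injective (cong suc))) (once n y))

_≟ᵛ_ : ∀ {k n} → DecidableEquality (Vec (Fin k) n)
_≟ᵛ_ = Vecₚ.≡-dec Finₚ._≟_

∑-allVec-suc : ∀ k n {f : Vec (Fin k) (suc n) → ℕ} →
               ∑ (allVec k (suc n)) f ≡ ∑ (allFin k) (λ j → ∑ (allVec k n) (λ c → f (j ∷ c)))
∑-allVec-suc k n = trans (∑-concatMap _ (allFin k)) (∑-cong (allFin k) (λ j → ∑-map (j ∷_) (allVec k n)))

vecEnum : ∀ k n → Enum (Vec (Fin k) n)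
vecEnum k n = record { elems = allVec k n ; _≟_ = _≟ᵛ_ ; once = once n }
  where
  once : ∀ n (v : Vec (Fin k) n) → ∑ (allVec k n) (λ u → 𝟙 (u ≟ᵛ v)) ≡ 1
  once zero    []      = refl
  once (suc n) (y ∷ v) = begin
    ∑ (allVec k (suc n)) (λ u → 𝟙 (u ≟ᵛ (y ∷ v)))
      ≡⟨ ∑-allVec-suc k n ⟩
    ∑ (allFin k) (λ x → ∑ (allVec k n) (λ u → 𝟙 ((x ∷ u) ≟ᵛ (y ∷ v))))
      ≡⟨ ∑-cong (allFin k) (λ x → ∑-cong (allVec k n) (λ u → trans
           (𝟙-⇔ ((x ∷ u) ≟ᵛ (y ∷ v)) ((x Finₚ.≟ y) ×-dec (u ≟ᵛ v))
             (λ eq → Vecₚ.∷-injective eq) (λ { (refl , refl) → refl }))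
           (𝟙-× (x Finₚ.≟ y) (u ≟ᵛ v)))) ⟩
    ∑ (allFin k) (λ x → ∑ (allVec k n) (λ u → 𝟙 (x Finₚ.≟ y) * 𝟙 (u ≟ᵛ v)))
      ≡⟨ ∑-cong (allFin k) (λ x → trans (∑-*ˡ (allVec k n) (𝟙 (x Finₚ.≟ y)))
           (cong (𝟙 (x Finₚ.≟ y) *_) (once n v))) ⟩
    ∑ (allFin k) (λ x → 𝟙 (x Finₚ.≟ y) * 1)
      ≡⟨ Enum.∑-δ (finEnum k) y (λ _ → 1) ⟩
    1 ∎
    where open ≡-Reasoning

-- The symmetric group

lookup-ext : {u v : Vec A n} → (∀ i → lookup u i ≡ lookup v i) → u ≡ v
lookup-ext {u = u} {v} eq =
  trans (sym (Vecₚ.tabulate∘lookup u)) (trans (Vecₚ.tabulate-cong eq) (Vecₚ.tabulate∘lookup v))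

perm-≡ : {σ τ : Perm n} → proj₁ σ ≡ proj₁ τ → σ ≡ τ
perm-≡ {σ = v , p} {.v , q} refl = cong (v ,_) (Boolₚ.T-irrelevant {⌊ isPerm? v ⌋} p q)

perm-ext : {σ τ : Perm n} → (∀ i → σ ⟨$⟩ i ≡ τ ⟨$⟩ i) → σ ≡ τ
perm-ext eq = perm-≡ (lookup-ext eq)

perm-inj : (σ : Perm n) → ∀ {i j} → σ ⟨$⟩ i ≡ σ ⟨$⟩ j → i ≡ j
perm-inj (_ , p) = toWitness p _ _

mkPerm : (f : Fin n → Fin n) → (∀ {i j} → f i ≡ f j → i ≡ j) → Perm n
mkPerm f inj = tabulate f , fromWitness (λ i j eq →
  inj (trans (sym (Vecₚ.lookup∘tabulate f i)) (trans eq (Vecₚ.lookup∘tabulate f j))))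

mkPerm-⟨$⟩ : (f : Fin n → Fin n) (inj : ∀ {i j} → f i ≡ f j → i ≡ j) →
             ∀ i → mkPerm f inj ⟨$⟩ i ≡ f i
mkPerm-⟨$⟩ f inj = Vecₚ.lookup∘tabulate f

_≟ₚ_ : DecidableEquality (Perm n)
σ ≟ₚ τ with proj₁ σ ≟ᵛ proj₁ τ
... | yes eq = yes (perm-≡ eq)
... | no ne  = no (λ eq → ne (cong proj₁ eq))

∑-mapMaybe : (g : A → Maybe B) (xs : List A) {f : B → ℕ} →
             ∑ (mapMaybe g xs) f ≡ ∑ xs (λ x → maybe′ f 0 (g x))
∑-mapMaybe g []       = refl
∑-mapMaybe g (x ∷ xs) with g x
... | just _  = cong (_ +_) (∑-mapMaybe g xs)
... | nothing = ∑-mapMaybe g xs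

permEnum : ∀ n → Enum (Perm n)
permEnum n = record { elems = allPerms n ; _≟_ = _≟ₚ_ ; once = once }
  where
  pointwise : ∀ σ v → maybe′ (λ τ → 𝟙 (τ ≟ₚ σ)) 0 (toPerm v) ≡ 𝟙 (v ≟ᵛ proj₁ σ)
  pointwise σ v with isPerm? v
  ... | yes p = 𝟙-⇔ ((v , fromWitness p) ≟ₚ σ) (v ≟ᵛ proj₁ σ) (cong proj₁) perm-≡
  ... | no ¬p = sym (𝟙-no (v ≟ᵛ proj₁ σ) (λ { refl → ¬p (toWitness (proj₂ σ)) }))

  once : ∀ σ → ∑ (allPerms n) (λ τ → 𝟙 (τ ≟ₚ σ)) ≡ 1
  once σ = trans (∑-mapMaybe toPerm (allVec n n))
    (trans (∑-cong (allVec n n) (pointwise σ)) (Enum.once (vecEnum n n) (proj₁ σ)))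

-- Iterates, composition and inverses of permutations

iter : Perm n → ℕ → Fin n → Fin n
iter σ zero    i = i
iter σ (suc t) i = σ ⟨$⟩ iter σ t i

iter-+ : (σ : Perm n) (s t : ℕ) (i : Fin n) → iter σ (s + t) i ≡ iter σ s (iter σ t i)
iter-+ σ zero    t i = refl
iter-+ σ (suc s) t i = cong (σ ⟨$⟩_) (iter-+ σ s t i)

iter-inj : (σ : Perm n) (t : ℕ) {i j : Fin n} → iter σ t i ≡ iter σ t j → i ≡ j
iter-inj σ zero    eq = eq
iter-inj σ (suc t) eq = iter-inj σ t (perm-inj σ eq)

iter-cancel : (σ : Perm n) {s t : ℕ} → s ≤ t → ∀ {i} → iter σ s i ≡ iter σ t i → iter σ (t ∸ s) i ≡ i
iter-cancel σ {s} {t} s≤t {i} eq = iter-inj σ s (begin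
  iter σ s (iter σ (t ∸ s) i) ≡⟨ iter-+ σ s (t ∸ s) i ⟨
  iter σ (s + (t ∸ s)) i      ≡⟨ cong (λ u → iter σ u i) (m+[n∸m]≡n s≤t) ⟩
  iter σ t i                  ≡⟨ eq ⟨
  iter σ s i                  ∎)
  where open ≡-Reasoning

-- Two of the iterates at times 0 to `n` coincide by the pigeonhole principle, and injectivity
-- cancels the earlier time. The bound on `p` later keeps searches along a cycle inside `Fin n` and
-- inside the fuel of `cycleLength`.
returns : (σ : Perm n) (i : Fin n) → ∃ λ p → p < n × iter σ (suc p) i ≡ i
returns {n} σ i with Finₚ.pigeonhole (n<1+n n) (λ t → iter σ (toℕ t) i)
... | s , t , s<t , eq with toℕ t ∸ toℕ s in d | iter-cancel σ (<⇒≤ s<t) eq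
...   | zero  | _   = ⊥-elim (<⇒≢ (m<n⇒0<n∸m s<t) (sym d))
...   | suc p | ret = p , ≤-trans (≤-reflexive (sym d)) (≤-trans (m∸n≤m (toℕ t) (toℕ s)) (Finₚ.toℕ≤pred[n] t)) , ret

idₚ : Perm n
idₚ = mkPerm id id

infixr 25 _∘ₚ_
_∘ₚ_ : Perm n → Perm n → Perm n
σ ∘ₚ τ = mkPerm (λ i → σ ⟨$⟩ (τ ⟨$⟩ i)) (perm-inj τ ∘ perm-inj σ)

idₚ-⟨$⟩ : (i : Fin n) → idₚ ⟨$⟩ i ≡ i
idₚ-⟨$⟩ = mkPerm-⟨$⟩ id id

∘ₚ-⟨$⟩ : (σ τ : Perm n) (i : Fin n) → (σ ∘ₚ τ) ⟨$⟩ i ≡ σ ⟨$⟩ (τ ⟨$⟩ i)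
∘ₚ-⟨$⟩ σ τ = mkPerm-⟨$⟩ (λ i → σ ⟨$⟩ (τ ⟨$⟩ i)) (perm-inj τ ∘ perm-inj σ)

-- The last point before the orbit of `i` comes back to `i`.
preimage : (σ : Perm n) (i : Fin n) → Fin n
preimage σ i = iter σ (proj₁ (returns σ i)) i

⟨$⟩-preimage : (σ : Perm n) (i : Fin n) → σ ⟨$⟩ preimage σ i ≡ i
⟨$⟩-preimage σ i = proj₂ (proj₂ (returns σ i))

preimage-inj : (σ : Perm n) → ∀ {i j} → preimage σ i ≡ preimage σ j → i ≡ j
preimage-inj σ {i} {j} eq =
  trans (sym (⟨$⟩-preimage σ i)) (trans (cong (σ ⟨$⟩_) eq) (⟨$⟩-preimage σ j))

infix 30 _⁻¹
_⁻¹ : Perm n → Perm n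
σ ⁻¹ = mkPerm (preimage σ) (preimage-inj σ)

inverseʳ : (σ : Perm n) (i : Fin n) → σ ⟨$⟩ (σ ⁻¹ ⟨$⟩ i) ≡ i
inverseʳ σ i = trans (cong (σ ⟨$⟩_) (mkPerm-⟨$⟩ (preimage σ) (preimage-inj σ) i)) (⟨$⟩-preimage σ i)

inverseˡ : (σ : Perm n) (i : Fin n) → σ ⁻¹ ⟨$⟩ (σ ⟨$⟩ i) ≡ i
inverseˡ σ i = perm-inj σ (inverseʳ σ (σ ⟨$⟩ i))

cancelˡ : (σ τ : Perm n) → σ ⁻¹ ∘ₚ (σ ∘ₚ τ) ≡ τ
cancelˡ σ τ = perm-ext (λ i → trans (∘ₚ-⟨$⟩ (σ ⁻¹) (σ ∘ₚ τ) i)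
  (trans (cong (σ ⁻¹ ⟨$⟩_) (∘ₚ-⟨$⟩ σ τ i)) (inverseˡ σ _)))

cancelˡ′ : (σ τ : Perm n) → σ ∘ₚ (σ ⁻¹ ∘ₚ τ) ≡ τ
cancelˡ′ σ τ = perm-ext (λ i → trans (∘ₚ-⟨$⟩ σ (σ ⁻¹ ∘ₚ τ) i)
  (trans (cong (σ ⟨$⟩_) (∘ₚ-⟨$⟩ (σ ⁻¹) τ i)) (inverseʳ σ _)))

cancelʳ : (σ τ : Perm n) → (σ ∘ₚ τ) ∘ₚ τ ⁻¹ ≡ σ
cancelʳ σ τ = perm-ext (λ i → trans (∘ₚ-⟨$⟩ (σ ∘ₚ τ) (τ ⁻¹) i)
  (trans (∘ₚ-⟨$⟩ σ τ _) (cong (σ ⟨$⟩_) (inverseʳ τ i))))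

cancelʳ′ : (σ τ : Perm n) → (σ ∘ₚ τ ⁻¹) ∘ₚ τ ≡ σ
cancelʳ′ σ τ = perm-ext (λ i → trans (∘ₚ-⟨$⟩ (σ ∘ₚ τ ⁻¹) τ i)
  (trans (∘ₚ-⟨$⟩ σ (τ ⁻¹) _) (cong (σ ⟨$⟩_) (inverseˡ τ i))))

∑-perm-∘ˡ : (τ : Perm n) (h : Perm n → ℕ) → ∑ (allPerms n) (λ σ → h (τ ∘ₚ σ)) ≡ ∑ (allPerms n) h
∑-perm-∘ˡ {n} τ = ∑-bij (permEnum n) (permEnum n) (τ ∘ₚ_) (τ ⁻¹ ∘ₚ_) (cancelˡ τ) (cancelˡ′ τ)

∑-perm-∘ʳ : (τ : Perm n) (h : Perm n → ℕ) → ∑ (allPerms n) (λ σ → h (σ ∘ₚ τ)) ≡ ∑ (allPerms n) h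
∑-perm-∘ʳ {n} τ = ∑-bij (permEnum n) (permEnum n) (_∘ₚ τ) (_∘ₚ τ ⁻¹)
  (λ σ → cancelʳ σ τ) (λ σ → cancelʳ′ σ τ)

-- This is the bijection behind (n+1)! = (n+1) · n!. It also serves in `rearrange` to extend a
-- matching of the remaining points by one more point.
consPerm : Fin (suc n) × Perm n → Perm (suc n)
consPerm {n} (p , ρ) = p ∷ Vec.map (punchIn p) (proj₁ ρ) , fromWitness inj
  where
  look : ∀ i → lookup (Vec.map (punchIn p) (proj₁ ρ)) i ≡ punchIn p (ρ ⟨$⟩ i)
  look i = Vecₚ.lookup-map i (punchIn p) (proj₁ ρ)

  inj : IsPerm (p ∷ Vec.map (punchIn p) (proj₁ ρ))
  inj zero    zero    eq = refl
  inj zero    (suc j) eq = ⊥-elim (Finₚ.punchInᵢ≢i p (ρ ⟨$⟩ j) (sym (trans eq (look j))))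
  inj (suc i) zero    eq = ⊥-elim (Finₚ.punchInᵢ≢i p (ρ ⟨$⟩ i) (trans (sym (look i)) eq))
  inj (suc i) (suc j) eq = cong suc (perm-inj ρ (Finₚ.punchIn-injective p _ _
    (trans (sym (look i)) (trans eq (look j)))))

unconsPerm : Perm (suc n) → Fin (suc n) × Perm n
unconsPerm σ = σ ⟨$⟩ zero , mkPerm (λ i → punchOut (off i))
  (λ {i} {j} eq → Finₚ.suc-injective (perm-inj σ (Finₚ.punchOut-injective (off i) (off j) eq)))
  where
  off : ∀ i → σ ⟨$⟩ zero ≢ σ ⟨$⟩ suc i
  off i eq = Finₚ.0≢1+n (perm-inj σ eq)

productEnum : Enum A → Enum B → Enum (A × B)
productEnum E F = record
  { elems = concatMap (λ x → map (x ,_) F.elems) E.elems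
  ; _≟_   = _≟_
  ; once  = λ { (a , b) → begin
      ∑ (concatMap (λ x → map (x ,_) F.elems) E.elems) (λ z → 𝟙 (z ≟ (a , b)))
        ≡⟨ ∑-concatMap _ E.elems ⟩
      ∑ E.elems (λ x → ∑ (map (x ,_) F.elems) (λ z → 𝟙 (z ≟ (a , b))))
        ≡⟨ ∑-cong E.elems (λ x → ∑-map (x ,_) F.elems) ⟩
      ∑ E.elems (λ x → ∑ F.elems (λ y → 𝟙 ((x , y) ≟ (a , b))))
        ≡⟨ ∑-cong E.elems (λ x → ∑-cong F.elems (λ y → trans
             (𝟙-⇔ ((x , y) ≟ (a , b)) ((x E.≟ a) ×-dec (y F.≟ b))
               (λ { refl → refl , refl }) (λ { (refl , refl) → refl }))
             (𝟙-× (x E.≟ a) (y F.≟ b)))) ⟩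
      ∑ E.elems (λ x → ∑ F.elems (λ y → 𝟙 (x E.≟ a) * 𝟙 (y F.≟ b)))
        ≡⟨ ∑-cong E.elems (λ x → trans (∑-*ˡ F.elems (𝟙 (x E.≟ a)))
             (cong (𝟙 (x E.≟ a) *_) (F.once b))) ⟩
      ∑ E.elems (λ x → 𝟙 (x E.≟ a) * 1)
        ≡⟨ E.∑-δ a (λ _ → 1) ⟩
      1 ∎ }
  }
  where
  open ≡-Reasoning
  module E = Enum E
  module F = Enum F
  _≟_ : DecidableEquality _
  _≟_ = ×-≡-dec E._≟_ F._≟_

∑-one : (xs : List A) → ∑ xs (λ _ → 1) ≡ length xs
∑-one []       = refl
∑-one (x ∷ xs) = cong suc (∑-one xs)

∑-const : (xs : List A) (a : ℕ) → ∑ xs (λ _ → a) ≡ ∑ xs (λ _ → 1) * a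
∑-const xs a = trans (∑-cong xs (λ _ → sym (*-identityˡ a))) (∑-*ʳ xs a)

∑-perms : ∀ n → ∑ (allPerms n) (λ _ → 1) ≡ n !
∑-perms zero    = refl
∑-perms (suc n) = begin
  ∑ (allPerms (suc n)) (λ _ → 1)
    ≡⟨ ∑-bij (productEnum (finEnum (suc n)) (permEnum n)) (permEnum (suc n)) consPerm unconsPerm
         uncons-cons cons-uncons (λ _ → 1) ⟨
  ∑ (concatMap (λ p → map (p ,_) (allPerms n)) (allFin (suc n))) (λ _ → 1)
    ≡⟨ ∑-concatMap (λ p → map (p ,_) (allPerms n)) (allFin (suc n)) ⟩
  ∑ (allFin (suc n)) (λ p → ∑ (map (p ,_) (allPerms n)) (λ _ → 1))
    ≡⟨ ∑-cong (allFin (suc n)) (λ p → trans (∑-map (p ,_) (allPerms n)) (∑-perms n)) ⟩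
  ∑ (allFin (suc n)) (λ _ → n !)
    ≡⟨ ∑-const (allFin (suc n)) (n !) ⟩
  ∑ (allFin (suc n)) (λ _ → 1) * n !
    ≡⟨ cong (_* n !) (trans (∑-one (allFin (suc n))) (Listₚ.length-tabulate {n = suc n} id)) ⟩
  suc n * n ! ∎
  where
  open ≡-Reasoning

  lookup-cons : ∀ (p : Fin (suc n)) (ρ : Perm n) i → consPerm (p , ρ) ⟨$⟩ suc i ≡ punchIn p (ρ ⟨$⟩ i)
  lookup-cons p ρ i = Vecₚ.lookup-map i (punchIn p) (proj₁ ρ)

  uncons-cons : ∀ x → unconsPerm (consPerm x) ≡ x
  uncons-cons (p , ρ) = cong (p ,_) (perm-ext (λ i → trans (Vecₚ.lookup∘tabulate _ i)
    (trans (Finₚ.punchOut-cong p {i≢k = λ eq → Finₚ.punchInᵢ≢i p (ρ ⟨$⟩ i) (sym eq)} (lookup-cons p ρ i)) (Finₚ.punchOut-punchIn p))))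

  cons-uncons : ∀ σ → consPerm (unconsPerm σ) ≡ σ
  cons-uncons σ = perm-ext λ
    { zero    → refl
    ; (suc i) → trans (lookup-cons (σ ⟨$⟩ zero) (proj₂ (unconsPerm σ)) i)
        (trans (cong (punchIn (σ ⟨$⟩ zero)) (Vecₚ.lookup∘tabulate _ i)) (Finₚ.punchIn-punchOut _)) }

-- Orbit counting

T-∧⁻ : ∀ {a b} → T (a ∧ b) → T a × T b
T-∧⁻ = Equivalence.to Boolₚ.T-∧

T-∧⁺ : ∀ {a b} → T a → T b → T (a ∧ b)
T-∧⁺ p q = Equivalence.from Boolₚ.T-∧ (p , q)

T-not⁻ : ∀ {b} → T (not b) → ¬ T b
T-not⁻ {false} _ ()

T-not⁺ : ∀ {b} → ¬ T b → T (not b)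
T-not⁺ {true}  ¬t = ¬t tt
T-not⁺ {false} _  = tt

𝟙-T-⌊⌋ : (d : Dec P) → 𝟙 (T-dec ⌊ d ⌋) ≡ 𝟙 d
𝟙-T-⌊⌋ (yes _) = refl
𝟙-T-⌊⌋ (no _)  = refl

least : {P : Fin n → Set} → (∀ i → Dec (P i)) → ∃ P →
        ∃ λ j → P j × (∀ l → P l → j Fin.≤ l)
least {suc n} P? (i , p) with P? zero
... | yes p₀ = zero , p₀ , λ _ _ → z≤n
least {suc n} P? (zero  , p) | no ¬p₀ = ⊥-elim (¬p₀ p)
least {suc n} P? (suc i , p) | no ¬p₀ with least (P? ∘ suc) (i , p)
... | j , pj , min = suc j , pj , λ { zero p₀ → ⊥-elim (¬p₀ p₀) ; (suc l) pl → s≤s (min l pl) }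

greatest : {P : Fin n → Set} → (∀ i → Dec (P i)) → ∃ P →
           ∃ λ j → P j × (∀ l → P l → l Fin.≤ j)
greatest {suc n} P? (i , p) with Finₚ.any? (P? ∘ suc)
... | yes q with greatest (P? ∘ suc) q
...   | j , pj , max = suc j , pj , λ { zero _ → z≤n ; (suc l) pl → s≤s (max l pl) }
greatest {suc n} P? (zero  , p) | no ¬q = zero , p , λ { zero _ → z≤n ; (suc l) pl → ⊥-elim (¬q (l , pl)) }
greatest {suc n} P? (suc i , p) | no ¬q = ⊥-elim (¬q (i , p))

-- This is the condition `σ · c = c` freed of the inverse. The type of colors is left open because
-- `coloringOf` takes values in `ℕ`, while the colorings to be counted take values in `Fin k`.
Preserves : (Fin n → A) → Perm n → Set
Preserves col σ = ∀ j → col (σ ⟨$⟩ j) ≡ col j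

preserves? : DecidableEquality A → (col : Fin n → A) (σ : Perm n) → Dec (Preserves col σ)
preserves? _≟_ col σ = Finₚ.all? (λ j → col (σ ⟨$⟩ j) ≟ col j)

module _ {col : Fin n → A} where

  preserves-id : Preserves col idₚ
  preserves-id j = cong col (idₚ-⟨$⟩ j)

  preserves-∘ : ∀ σ τ → Preserves col σ → Preserves col τ → Preserves col (σ ∘ₚ τ)
  preserves-∘ σ τ p q j = trans (cong col (∘ₚ-⟨$⟩ σ τ j)) (trans (p (τ ⟨$⟩ j)) (q j))

  preserves-⁻¹ : ∀ σ → Preserves col σ → Preserves col (σ ⁻¹)
  preserves-⁻¹ σ p j = trans (sym (p (σ ⁻¹ ⟨$⟩ j))) (cong col (inverseʳ σ j))

  preserves-cancelʳ : ∀ σ τ → Preserves col τ → Preserves col (σ ∘ₚ τ) → Preserves col σ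
  preserves-cancelʳ σ τ p q =
    subst (Preserves col) (cancelʳ σ τ) (preserves-∘ (σ ∘ₚ τ) (τ ⁻¹) q (preserves-⁻¹ τ p))

fixesColoring⇒ : (σ : Perm n) (col : Fin n → ℕ) → T (fixesColoring σ col) → Preserves col σ
fixesColoring⇒ {n} σ col t j
  with Enum.all-T (finEnum n) _ (Enum.all-T (finEnum n) _ t (σ ⟨$⟩ j)) j
... | s with σ ⟨$⟩ j Finₚ.≟ σ ⟨$⟩ j
...   | yes _ = sym (toWitness s)
...   | no ne = ⊥-elim (ne refl)

fixesColoring⇐ : (σ : Perm n) (col : Fin n → ℕ) → Preserves col σ → T (fixesColoring σ col)
fixesColoring⇐ {n} σ col p = T-all _ (allFin n) (λ i → T-all _ (allFin n) (λ j → pair i j))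
  where
  pair : ∀ i j → T (not ⌊ σ ⟨$⟩ j Finₚ.≟ i ⌋ ∨ ⌊ col j ℕₚ.≟ col i ⌋)
  pair i j with σ ⟨$⟩ j Finₚ.≟ i
  ... | yes refl = fromWitness (sym (p j))
  ... | no _     = tt

module Burnside {c ℓ : Level} {Γ : Group c ℓ} (F : ΓSpecies Γ) {k : ℕ} (π : Vec ℕ k) where
  open ΓSpecies F

  private
    N : ℕ
    N = Vec.sum π

    S : Set
    S = Fin (size N)

    structures : List S
    structures = allFin (size N)

    col : Fin N → ℕ
    col = coloringOf π

  stab? : (σ : Perm N) → Dec (Preserves col σ)
  stab? = preserves? ℕₚ._≟_ col

  _~_ : S → S → Set
  x ~ y = ∃ λ σ → Preserves col σ × tr σ x ≡ y

  sameOrbit⇒ : ∀ {x y} → T (sameOrbit F π x y) → x ~ y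
  sameOrbit⇒ t with any-T _ (allPerms N) t
  ... | σ , s = σ , fixesColoring⇒ σ col (proj₁ (T-∧⁻ s)) ,
                toWitness (proj₂ (T-∧⁻ {fixesColoring σ col} s))

  sameOrbit⇐ : ∀ {x y} → x ~ y → T (sameOrbit F π x y)
  sameOrbit⇐ (σ , p , eq) = Enum.T-any (permEnum N) _ {σ}
    (T-∧⁺ (fixesColoring⇐ σ col p) (fromWitness eq))

  _~?_ : (x y : S) → Dec (x ~ y)
  x ~? y = map′ sameOrbit⇒ sameOrbit⇐ (T-dec (sameOrbit F π x y))

  tr-∘ₚ : (σ τ : Perm N) (x : S) → tr (σ ∘ₚ τ) x ≡ tr σ (tr τ x)
  tr-∘ₚ σ τ = tr-∘ τ σ (σ ∘ₚ τ) (∘ₚ-⟨$⟩ σ τ)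

  tr-⁻¹ˡ : (σ : Perm N) (x : S) → tr (σ ⁻¹) (tr σ x) ≡ x
  tr-⁻¹ˡ σ x = trans (sym (tr-∘ₚ (σ ⁻¹) σ x))
    (tr-id (σ ⁻¹ ∘ₚ σ) (λ i → trans (∘ₚ-⟨$⟩ (σ ⁻¹) σ i) (inverseˡ σ i)) x)

  tr-⁻¹ʳ : (σ : Perm N) (x : S) → tr σ (tr (σ ⁻¹) x) ≡ x
  tr-⁻¹ʳ σ x = trans (sym (tr-∘ₚ σ (σ ⁻¹) x))
    (tr-id (σ ∘ₚ σ ⁻¹) (λ i → trans (∘ₚ-⟨$⟩ σ (σ ⁻¹) i) (inverseʳ σ i)) x)

  ~-refl : ∀ {x} → x ~ x
  ~-refl = idₚ , preserves-id , tr-id idₚ idₚ-⟨$⟩ _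

  ~-sym : ∀ {x y} → x ~ y → y ~ x
  ~-sym (σ , p , refl) = σ ⁻¹ , preserves-⁻¹ σ p , tr-⁻¹ˡ σ _

  ~-trans : ∀ {x y z} → x ~ y → y ~ z → x ~ z
  ~-trans (σ , p , refl) (τ , q , refl) = τ ∘ₚ σ , preserves-∘ τ σ q p , tr-∘ₚ τ σ _

  ~-act : ∀ γ {x y} → x ~ y → act γ x ~ act γ y
  ~-act γ (σ , p , refl) = σ , p , sym (act-tr γ σ _)

  carriers : S → S → ℕ
  carriers x y = ∑ (allPerms N) (λ σ → 𝟙 (stab? σ) * 𝟙 (tr σ x Finₚ.≟ y))

  -- If `τ` carries `x` to `x′`, right multiplication by `τ` matches the elements carrying `x′` to
  -- `y` with those carrying `x` to `y`.
  carriers-cong : ∀ {x x′} → x ~ x′ → ∀ y → carriers x′ y ≡ carriers x y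
  carriers-cong {x} (τ , p , refl) y = trans
    (∑-cong (allPerms N) (λ σ → cong₂ _*_
      (𝟙-⇔ (stab? σ) (stab? (σ ∘ₚ τ)) (λ q → preserves-∘ σ τ q p) (preserves-cancelʳ σ τ p))
      (𝟙-⇔ (tr σ (tr τ x) Finₚ.≟ y) (tr (σ ∘ₚ τ) x Finₚ.≟ y)
        (trans (tr-∘ₚ σ τ x)) (trans (sym (tr-∘ₚ σ τ x))))))
    (∑-perm-∘ʳ τ (λ σ → 𝟙 (stab? σ) * 𝟙 (tr σ x Finₚ.≟ y)))

  carriers-≁ : ∀ {x y} → ¬ (x ~ y) → carriers x y ≡ 0
  carriers-≁ {x} {y} ≁ = ∑-zero (allPerms N) λ σ →
    𝟙-vanish (stab? σ) (λ p → 𝟙-no (tr σ x Finₚ.≟ y) (λ eq → ≁ (σ , p , eq)))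

  stabOrder : ℕ
  stabOrder = ∑ (allPerms N) (λ σ → 𝟙 (stab? σ))

  -- Each element of the stabilizer carries `x` to exactly one structure, hence is counted once.
  ∑-carriers : ∀ x → ∑ structures (carriers x) ≡ stabOrder
  ∑-carriers x = begin
    ∑ structures (carriers x)
      ≡⟨ ∑-swap structures (allPerms N) ⟩
    ∑ (allPerms N) (λ σ → ∑ structures (λ y → 𝟙 (stab? σ) * 𝟙 (tr σ x Finₚ.≟ y)))
      ≡⟨ ∑-cong (allPerms N) (λ σ → trans (∑-*ˡ structures (𝟙 (stab? σ)))
           (cong (𝟙 (stab? σ) *_) (trans
             (∑-cong structures (λ y → 𝟙-⇔ (tr σ x Finₚ.≟ y) (y Finₚ.≟ tr σ x) sym sym))
             (Enum.once (finEnum (size N)) (tr σ x))))) ⟩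
    ∑ (allPerms N) (λ σ → 𝟙 (stab? σ) * 1)
      ≡⟨ ∑-cong (allPerms N) (λ σ → *-identityʳ (𝟙 (stab? σ))) ⟩
    stabOrder ∎
    where open ≡-Reasoning

  Canonical : S → Set
  Canonical x = ∀ y → y ~ x → x Fin.≤ y

  canonical? : ∀ x → Dec (Canonical x)
  canonical? x = map′ sound complete (T-dec (isCanonical F π x))
    where
    smaller : S → Bool
    smaller y = ⌊ toℕ y ℕₚ.<? toℕ x ⌋ ∧ sameOrbit F π y x

    sound : T (isCanonical F π x) → Canonical x
    sound t y r = ≮⇒≥ (λ y<x → T-not⁻ t (Enum.T-any (finEnum (size N)) smaller {y}
      (T-∧⁺ (fromWitness y<x) (sameOrbit⇐ r))))

    complete : Canonical x → T (isCanonical F π x)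
    complete can = T-not⁺ (λ t →
      let y , s     = any-T smaller structures t
          y<x , y~x = T-∧⁻ {⌊ toℕ y ℕₚ.<? toℕ x ⌋} s
      in <⇒≱ (toWitness y<x) (can y (sameOrbit⇒ y~x)))

  -- The only canonical member of a class is its least element. Inserted as a factor 1, this
  -- identity turns a sum over structures into a sum over orbits.
  one-canonical : ∀ y → ∑ structures (λ x → 𝟙 (canonical? x) * 𝟙 (x ~? y)) ≡ 1
  one-canonical y with least (λ x → x ~? y) (y , ~-refl)
  ... | m , m~y , min = trans
    (∑-cong structures (λ x → trans (sym (𝟙-× (canonical? x) (x ~? y)))
      (𝟙-⇔ (canonical? x ×-dec (x ~? y)) (x Finₚ.≟ m)
        (λ { (can , x~y) → Finₚ.≤-antisym (can m (~-trans m~y (~-sym x~y))) (min x x~y) })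
        (λ { refl → (λ z z~m → min z (~-trans z~m m~y)) , m~y }))))
    (Enum.once (finEnum (size N)) m)

  -- Within the orbit of x the summand equals carriers (act γ x) y, so only
  -- orbits meeting their γ-image contribute.
  orbit-sum : ∀ γ x → ∑ structures (λ y → 𝟙 (x ~? y) * carriers (act γ y) y)
                      ≡ 𝟙 (x ~? act γ x) * stabOrder
  orbit-sum γ x = by-cases (x ~? act γ x)
    where
    open ≡-Reasoning
    by-cases : (d : Dec (x ~ act γ x)) →
               ∑ structures (λ y → 𝟙 (x ~? y) * carriers (act γ y) y) ≡ 𝟙 d * stabOrder
    by-cases (yes r) = begin
      ∑ structures (λ y → 𝟙 (x ~? y) * carriers (act γ y) y)
        ≡⟨ ∑-cong structures (λ y → 𝟙-guard (x ~? y) (λ x~y →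
             carriers-cong (~-trans r (~-act γ x~y)) y)) ⟩
      ∑ structures (λ y → 𝟙 (x ~? y) * carriers x y)
        ≡⟨ ∑-cong structures (λ y → 𝟙-absorb (x ~? y) carriers-≁) ⟩
      ∑ structures (carriers x)
        ≡⟨ ∑-carriers x ⟩
      stabOrder
        ≡⟨ *-identityˡ stabOrder ⟨
      1 * stabOrder ∎
    by-cases (no ¬r) = ∑-zero structures (λ y → 𝟙-vanish (x ~? y) (λ x~y → carriers-≁ (λ γy~y →
      ¬r (~-sym (~-trans (~-trans (~-act γ x~y) γy~y) (~-sym x~y))))))

  numFixedPL-∑ : ∀ γ → numFixedPL F π γ ≡ ∑ structures (λ x → 𝟙 (canonical? x) * 𝟙 (x ~? act γ x))
  numFixedPL-∑ γ = trans (count-∑ _ structures) (∑-cong structures (λ x → trans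
    (𝟙-⇔ (T-dec (isCanonical F π x ∧ sameOrbit F π x (act γ x)))
         (T-dec (isCanonical F π x) ×-dec T-dec (sameOrbit F π x (act γ x)))
         T-∧⁻ (λ { (p , q) → T-∧⁺ p q }))
    (𝟙-× (T-dec (isCanonical F π x)) (T-dec (sameOrbit F π x (act γ x))))))

  burnside : ∀ γ → ∑ (allPerms N) (λ σ → 𝟙 (stab? σ) * fixCount F γ σ) ≡ numFixedPL F π γ * stabOrder
  burnside γ = begin
    ∑ (allPerms N) (λ σ → 𝟙 (stab? σ) * fixCount F γ σ)
      -- Since `γ` commutes with transport, `y` is fixed by `γ` after `σ` exactly when `σ` carries
      -- `act γ y` to `y`.
      ≡⟨ ∑-cong (allPerms N) (λ σ → trans
           (cong (𝟙 (stab? σ) *_) (trans (count-∑ _ structures) (∑-cong structures (λ y → trans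
             (𝟙-T-⌊⌋ (act γ (tr σ y) Finₚ.≟ y))
             (cong (λ z → 𝟙 (z Finₚ.≟ y)) (act-tr γ σ y))))))
           (sym (∑-*ˡ structures (𝟙 (stab? σ))))) ⟩
    ∑ (allPerms N) (λ σ → ∑ structures (λ y → 𝟙 (stab? σ) * 𝟙 (tr σ (act γ y) Finₚ.≟ y)))
      ≡⟨ ∑-swap (allPerms N) structures ⟩
    ∑ structures (λ y → carriers (act γ y) y)
      -- The factor 1 from `one-canonical` groups the structures by orbit.
      ≡⟨ ∑-cong structures (λ y → trans (sym (*-identityˡ _))
           (trans (cong (_* carriers (act γ y) y) (sym (one-canonical y)))
             (sym (∑-*ʳ structures (carriers (act γ y) y))))) ⟩
    ∑ structures (λ y → ∑ structures (λ x → 𝟙 (canonical? x) * 𝟙 (x ~? y) * carriers (act γ y) y))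
      ≡⟨ ∑-swap structures structures ⟩
    ∑ structures (λ x → ∑ structures (λ y → 𝟙 (canonical? x) * 𝟙 (x ~? y) * carriers (act γ y) y))
      ≡⟨ ∑-cong structures (λ x → trans
           (∑-cong structures (λ y → *-assoc (𝟙 (canonical? x)) (𝟙 (x ~? y)) _))
           (trans (∑-*ˡ structures (𝟙 (canonical? x)))
             (trans (cong (𝟙 (canonical? x) *_) (orbit-sum γ x))
               (sym (*-assoc (𝟙 (canonical? x)) (𝟙 (x ~? act γ x)) stabOrder))))) ⟩
    ∑ structures (λ x → 𝟙 (canonical? x) * 𝟙 (x ~? act γ x) * stabOrder)
      ≡⟨ ∑-*ʳ structures stabOrder ⟩
    ∑ structures (λ x → 𝟙 (canonical? x) * 𝟙 (x ~? act γ x)) * stabOrder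
      ≡⟨ cong (_* stabOrder) (numFixedPL-∑ γ) ⟨
    numFixedPL F π γ * stabOrder ∎
    where open ≡-Reasoning

-- Colorings with given content

-- This is `c_π` with colors in `Fin k`, comparable with the vectors listed by `allVec`. Its colors
-- start at 0 and those of `blockOf` at 1, hence the shift in `blockOf-blockFin`.
blockFin : (π : Vec ℕ k) → Fin (Vec.sum π) → Fin k
blockFin (a ∷ π) i = [ (λ _ → zero) , suc ∘ blockFin π ]′ (splitAt a i)

blockOf-blockFin : (π : Vec ℕ k) (i : Fin (Vec.sum π)) → coloringOf π i ≡ suc (toℕ (blockFin π i))
blockOf-blockFin (a ∷ π) i with splitAt a i in eq
... | inj₁ x with toℕ i ℕₚ.<? a
...   | yes _  = refl
...   | no i≮a = ⊥-elim (i≮a (subst (_< a)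
        (trans (sym (Finₚ.toℕ-↑ˡ x (Vec.sum π))) (cong toℕ (Finₚ.splitAt⁻¹-↑ˡ eq))) (Finₚ.toℕ<n x)))
blockOf-blockFin (a ∷ π) i | inj₂ y with trans (sym (cong toℕ (Finₚ.splitAt⁻¹-↑ʳ {m = a} eq))) (Finₚ.toℕ-↑ʳ a y)
... | i≡a+y with toℕ i ℕₚ.<? a
...   | yes i<a = ⊥-elim (m+n≮m a (toℕ y) (subst (_< a) i≡a+y i<a))
...   | no _    = cong suc (trans
        (cong (blockOf π) (trans (cong (_∸ a) i≡a+y) (m+n∸m≡n a (toℕ y)))) (blockOf-blockFin π y))

∑-allFin-+ : ∀ m n (f : Fin (m + n) → ℕ) →
             ∑ (allFin (m + n)) f ≡ ∑ (allFin m) (λ i → f (i ↑ˡ n)) + ∑ (allFin n) (λ i → f (m ↑ʳ i))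
∑-allFin-+ zero    n f = refl
∑-allFin-+ (suc m) n f = begin
  ∑ (allFin (suc (m + n))) f
    ≡⟨ ∑-allFin-suc (m + n) f ⟩
  f zero + ∑ (allFin (m + n)) (f ∘ suc)
    ≡⟨ cong (f zero +_) (∑-allFin-+ m n (f ∘ suc)) ⟩
  f zero + (∑ (allFin m) (λ i → f (suc (i ↑ˡ n))) + ∑ (allFin n) (λ i → f (suc (m ↑ʳ i))))
    ≡⟨ +-assoc (f zero) _ _ ⟨
  f zero + ∑ (allFin m) (λ i → f (suc (i ↑ˡ n))) + ∑ (allFin n) (λ i → f (suc (m ↑ʳ i)))
    ≡⟨ cong (_+ ∑ (allFin n) (λ i → f (suc (m ↑ʳ i)))) (∑-allFin-suc m (λ i → f (i ↑ˡ n))) ⟨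
  ∑ (allFin (suc m)) (λ i → f (i ↑ˡ n)) + ∑ (allFin n) (λ i → f (suc m ↑ʳ i)) ∎
  where open ≡-Reasoning

∑-allFin-1 : ∀ n → ∑ (allFin n) (λ _ → 1) ≡ n
∑-allFin-1 n = trans (∑-one (allFin n)) (Listₚ.length-tabulate {n = n} id)

fibre : (Fin n → Fin k) → Fin k → ℕ
fibre {n} c j = ∑ (allFin n) (λ i → 𝟙 (c i Finₚ.≟ j))

fibre-blockFin : (π : Vec ℕ k) (j : Fin k) → fibre (blockFin π) j ≡ lookup π j
fibre-blockFin (a ∷ π) j = begin
  fibre (blockFin (a ∷ π)) j
    ≡⟨ ∑-allFin-+ a (Vec.sum π) _ ⟩
  ∑ (allFin a) (λ i → 𝟙 (blockFin (a ∷ π) (i ↑ˡ Vec.sum π) Finₚ.≟ j)) +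
  ∑ (allFin (Vec.sum π)) (λ i → 𝟙 (blockFin (a ∷ π) (a ↑ʳ i) Finₚ.≟ j))
    ≡⟨ cong₂ _+_
         (∑-cong (allFin a) (λ i → cong (λ s → 𝟙 ([ (λ _ → zero) , suc ∘ blockFin π ]′ s Finₚ.≟ j))
           (Finₚ.splitAt-↑ˡ a i (Vec.sum π))))
         (∑-cong (allFin (Vec.sum π)) (λ i → cong (λ s → 𝟙 ([ (λ _ → zero) , suc ∘ blockFin π ]′ s Finₚ.≟ j))
           (Finₚ.splitAt-↑ʳ a (Vec.sum π) i))) ⟩
  ∑ (allFin a) (λ _ → 𝟙 (zero Finₚ.≟ j)) + ∑ (allFin (Vec.sum π)) (λ i → 𝟙 (suc (blockFin π i) Finₚ.≟ j))
    ≡⟨ by-cases j ⟩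
  lookup (a ∷ π) j ∎
  where
  open ≡-Reasoning
  by-cases : ∀ j → ∑ (allFin a) (λ _ → 𝟙 (zero Finₚ.≟ j)) +
                   ∑ (allFin (Vec.sum π)) (λ i → 𝟙 (suc (blockFin π i) Finₚ.≟ j)) ≡ lookup (a ∷ π) j
  by-cases zero    = trans (cong₂ _+_ (∑-allFin-1 a) (∑-zero (allFin (Vec.sum π)) (λ _ → refl))) (+-identityʳ a)
  by-cases (suc j) = cong₂ _+_ {y = 0} (∑-zero (allFin a) (λ _ → refl))
    (trans (∑-cong (allFin (Vec.sum π)) (λ i →
      𝟙-⇔ (suc (blockFin π i) Finₚ.≟ suc j) (blockFin π i Finₚ.≟ j) Finₚ.suc-injective (cong suc)))
      (fibre-blockFin π j))

∑-punchIn : ∀ {n} (p : Fin (suc n)) (f : Fin (suc n) → ℕ) →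
            ∑ (allFin (suc n)) f ≡ f p + ∑ (allFin n) (f ∘ punchIn p)
∑-punchIn {n}     zero    f = ∑-allFin-suc n f
∑-punchIn {suc n} (suc p) f = begin
  ∑ (allFin (suc (suc n))) f
    ≡⟨ ∑-allFin-suc (suc n) f ⟩
  f zero + ∑ (allFin (suc n)) (f ∘ suc)
    ≡⟨ cong (f zero +_) (∑-punchIn p (f ∘ suc)) ⟩
  f zero + (f (suc p) + ∑ (allFin n) (f ∘ suc ∘ punchIn p))
    ≡⟨ x∙yz≈y∙xz (f zero) (f (suc p)) _ ⟩
  f (suc p) + (f zero + ∑ (allFin n) (f ∘ suc ∘ punchIn p))
    ≡⟨ cong (f (suc p) +_) (∑-allFin-suc n (f ∘ punchIn (suc p))) ⟨
  f (suc p) + ∑ (allFin (suc n)) (f ∘ punchIn (suc p)) ∎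
  where open ≡-Reasoning

∑-witness : (xs : List A) {f : A → ℕ} → ∑ xs f ≢ 0 → ∃ λ x → f x ≢ 0
∑-witness []           ne = ⊥-elim (ne refl)
∑-witness (x ∷ xs) {f} ne with f x in eq
... | suc _ = x , λ fx≡0 → 1+n≢0 (trans (sym eq) fx≡0)
... | zero  = ∑-witness xs ne

𝟙-≢0 : (d : Dec P) → 𝟙 d ≢ 0 → P
𝟙-≢0 (yes p) _  = p
𝟙-≢0 (no _)  ne = ⊥-elim (ne refl)

-- Equal fibre sizes provide a point `p` where `u` takes the value `v zero`. Removing `p` on one
-- side and 0 on the other lowers the same fibre by one on both sides, so the induction continues,
-- and `consPerm` adds the pair back.
rearrange : (u v : Fin n → Fin k) → (∀ j → fibre u j ≡ fibre v j) →
            ∃ λ (τ : Perm n) → ∀ i → u (τ ⟨$⟩ i) ≡ v i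
rearrange {zero}  u v eq = idₚ , λ ()
rearrange {suc n} u v eq with ∑-witness (allFin (suc n)) {λ i → 𝟙 (u i Finₚ.≟ v zero)} nonempty
  where
  nonempty : fibre u (v zero) ≢ 0
  nonempty z = 1+n≢0 (trans (sym (cong₂ _+_ (𝟙-yes (v zero Finₚ.≟ v zero) refl) refl))
    (trans (sym (∑-allFin-suc n (λ i → 𝟙 (v i Finₚ.≟ v zero)))) (trans (sym (eq (v zero))) z)))
... | p , ne with 𝟙-≢0 (u p Finₚ.≟ v zero) ne
...   | up≡v₀ with rearrange (u ∘ punchIn p) (v ∘ suc) (λ j → +-cancelˡ-≡ (𝟙 (v zero Finₚ.≟ j)) _ _ (begin
    𝟙 (v zero Finₚ.≟ j) + fibre (u ∘ punchIn p) j
      ≡⟨ cong (λ a → 𝟙 (a Finₚ.≟ j) + fibre (u ∘ punchIn p) j) up≡v₀ ⟨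
    𝟙 (u p Finₚ.≟ j) + fibre (u ∘ punchIn p) j
      ≡⟨ ∑-punchIn p (λ i → 𝟙 (u i Finₚ.≟ j)) ⟨
    fibre u j
      ≡⟨ eq j ⟩
    fibre v j
      ≡⟨ ∑-allFin-suc n (λ i → 𝟙 (v i Finₚ.≟ j)) ⟩
    𝟙 (v zero Finₚ.≟ j) + fibre (v ∘ suc) j ∎))
  where open ≡-Reasoning
...     | ρ , uρ≡v = consPerm (p , ρ) , λ
  { zero    → up≡v₀
  ; (suc i) → trans (cong u (Vecₚ.lookup-map i (punchIn p) (proj₁ ρ))) (uρ≡v i) }

fibre-perm : (τ : Perm n) (c : Fin n → Fin k) (j : Fin k) → fibre (λ i → c (τ ⟨$⟩ i)) j ≡ fibre c j
fibre-perm {n} τ c j = ∑-bij (finEnum n) (finEnum n) (τ ⟨$⟩_) (τ ⁻¹ ⟨$⟩_)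
  (inverseˡ τ) (inverseʳ τ) (λ i → 𝟙 (c i Finₚ.≟ j))

content : Vec (Fin k) n → Vec ℕ k
content c = tabulate (fibre (lookup c))

_≟ᵉ_ : DecidableEquality (Vec ℕ k)
_≟ᵉ_ = Vecₚ.≡-dec ℕₚ._≟_

invariantColorings : Perm n → Vec ℕ k → ℕ
invariantColorings {n} {k} σ α =
  ∑ (allVec k n) (λ c → 𝟙 (preserves? Finₚ._≟_ (lookup c) σ) * 𝟙 (content c ≟ᵉ α))

-- Invariant colorings and conjugates lying in the stabilizer

module Conjugation {c ℓ : Level} {Γ : Group c ℓ} (F : ΓSpecies Γ) {k : ℕ} (π : Vec ℕ k) where
  open ΓSpecies F
  open Burnside F π

  private
    N : ℕ
    N = Vec.sum π

    χ : Fin N → Fin k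
    χ = blockFin π

  preserves-χ⇒ : ∀ σ → Preserves (coloringOf π) σ → Preserves χ σ
  preserves-χ⇒ σ p j = Finₚ.toℕ-injective (suc-injective (trans (sym (blockOf-blockFin π (σ ⟨$⟩ j)))
    (trans (p j) (blockOf-blockFin π j))))

  preserves-χ⇐ : ∀ σ → Preserves χ σ → Preserves (coloringOf π) σ
  preserves-χ⇐ σ p j = trans (blockOf-blockFin π (σ ⟨$⟩ j))
    (trans (cong (suc ∘ toℕ) (p j)) (sym (blockOf-blockFin π j)))

  Sorts : Perm N → Vec (Fin k) N → Set
  Sorts τ c = ∀ i → lookup c (τ ⟨$⟩ i) ≡ χ i

  sorts? : ∀ τ c → Dec (Sorts τ c)
  sorts? τ c = Finₚ.all? (λ i → lookup c (τ ⟨$⟩ i) Finₚ.≟ χ i)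

  sorts⇒content : ∀ τ c → Sorts τ c → content c ≡ π
  sorts⇒content τ c s = lookup-ext (λ j → begin
    lookup (content c) j                   ≡⟨ Vecₚ.lookup∘tabulate _ j ⟩
    fibre (lookup c) j                     ≡⟨ fibre-perm τ (lookup c) j ⟨
    fibre (λ i → lookup c (τ ⟨$⟩ i)) j     ≡⟨ ∑-cong (allFin N) (λ i → cong (λ a → 𝟙 (a Finₚ.≟ j)) (s i)) ⟩
    fibre χ j                              ≡⟨ fibre-blockFin π j ⟩
    lookup π j                             ∎)
    where open ≡-Reasoning

  content⇒sorts : ∀ c → content c ≡ π → ∃ λ τ → Sorts τ c
  content⇒sorts c eq = rearrange (lookup c) χ (λ j → begin
    fibre (lookup c) j   ≡⟨ Vecₚ.lookup∘tabulate _ j ⟨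
    lookup (content c) j ≡⟨ cong (λ α → lookup α j) eq ⟩
    lookup π j           ≡⟨ fibre-blockFin π j ⟨
    fibre χ j            ∎)
    where open ≡-Reasoning

  -- A coloring with the right content is sorted by some `τ₀`, and then the permutations sorting it
  -- form the left coset of the stabilizer through `τ₀`. With any other content it is sorted by
  -- none.
  ∑-sorts : ∀ c → ∑ (allPerms N) (λ τ → 𝟙 (sorts? τ c)) ≡ 𝟙 (content c ≟ᵉ π) * stabOrder
  ∑-sorts c = by-cases (content c ≟ᵉ π)
    where
    open ≡-Reasoning
    by-cases : (d : Dec (content c ≡ π)) → ∑ (allPerms N) (λ τ → 𝟙 (sorts? τ c)) ≡ 𝟙 d * stabOrder
    by-cases (no ne)  = ∑-zero (allPerms N) (λ τ → 𝟙-no (sorts? τ c) (ne ∘ sorts⇒content τ c))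
    by-cases (yes eq) with content⇒sorts c eq
    ... | τ₀ , s = begin
      ∑ (allPerms N) (λ τ → 𝟙 (sorts? τ c))
        ≡⟨ ∑-perm-∘ˡ τ₀ (λ τ → 𝟙 (sorts? τ c)) ⟨
      ∑ (allPerms N) (λ σ → 𝟙 (sorts? (τ₀ ∘ₚ σ) c))
        ≡⟨ ∑-cong (allPerms N) (λ σ → 𝟙-⇔ (sorts? (τ₀ ∘ₚ σ) c) (stab? σ)
             (λ t → preserves-χ⇐ σ (λ j → trans (sym (at-τ₀ σ j)) (t j)))
             (λ p j → trans (at-τ₀ σ j) (preserves-χ⇒ σ p j))) ⟩
      stabOrder
        ≡⟨ *-identityˡ stabOrder ⟨
      1 * stabOrder ∎
      where
      at-τ₀ : ∀ σ j → lookup c ((τ₀ ∘ₚ σ) ⟨$⟩ j) ≡ χ (σ ⟨$⟩ j)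
      at-τ₀ σ j = trans (cong (lookup c) (∘ₚ-⟨$⟩ τ₀ σ j)) (s (σ ⟨$⟩ j))

  conj : Perm N → Perm N → Perm N
  conj τ σ = τ ⁻¹ ∘ₚ (σ ∘ₚ τ)

  conj-⟨$⟩ : ∀ τ σ i → τ ⟨$⟩ (conj τ σ ⟨$⟩ i) ≡ σ ⟨$⟩ (τ ⟨$⟩ i)
  conj-⟨$⟩ τ σ i = trans (cong (τ ⟨$⟩_) (∘ₚ-⟨$⟩ (τ ⁻¹) (σ ∘ₚ τ) i))
    (trans (inverseʳ τ _) (∘ₚ-⟨$⟩ σ τ i))

  ∑-conj : ∀ τ (h : Perm N → ℕ) → ∑ (allPerms N) (λ σ → h (conj τ σ)) ≡ ∑ (allPerms N) h
  ∑-conj τ h = trans (∑-perm-∘ʳ τ (λ σ → h (τ ⁻¹ ∘ₚ σ))) (∑-perm-∘ˡ (τ ⁻¹) h)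

  fixCount-∑ : ∀ γ (σ : Perm N) →
               fixCount F γ σ ≡ ∑ (allFin (size N)) (λ x → 𝟙 (act γ (tr σ x) Finₚ.≟ x))
  fixCount-∑ γ σ = trans (count-∑ _ (allFin (size N)))
    (∑-cong (allFin (size N)) (λ x → 𝟙-T-⌊⌋ (act γ (tr σ x) Finₚ.≟ x)))

  tr-inj : ∀ (τ : Perm N) {x y} → tr τ x ≡ tr τ y → x ≡ y
  tr-inj τ {x} {y} eq = trans (sym (tr-⁻¹ˡ τ x)) (trans (cong (tr (τ ⁻¹)) eq) (tr-⁻¹ˡ τ y))

  -- Transport along `τ` commutes with `γ`, so it maps the fixed points belonging to `conj τ σ`
  -- bijectively onto those belonging to `σ`.
  fixCount-conj : ∀ γ τ σ → fixCount F γ (conj τ σ) ≡ fixCount F γ σ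
  fixCount-conj γ τ σ = begin
    fixCount F γ (conj τ σ)
      ≡⟨ fixCount-∑ γ (conj τ σ) ⟩
    ∑ (allFin (size N)) (λ x → 𝟙 (act γ (tr (conj τ σ) x) Finₚ.≟ x))
      ≡⟨ ∑-cong (allFin (size N)) (λ x → 𝟙-⇔ (act γ (tr (conj τ σ) x) Finₚ.≟ x)
           (act γ (tr σ (tr τ x)) Finₚ.≟ tr τ x)
           (λ eq → trans (sym (moved x)) (cong (tr τ) eq))
           (λ eq → tr-inj τ (trans (moved x) eq))) ⟩
    ∑ (allFin (size N)) (λ x → 𝟙 (act γ (tr σ (tr τ x)) Finₚ.≟ tr τ x))
      ≡⟨ ∑-bij (finEnum (size N)) (finEnum (size N)) (tr τ) (tr (τ ⁻¹)) (tr-⁻¹ˡ τ) (tr-⁻¹ʳ τ)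
           (λ x → 𝟙 (act γ (tr σ x) Finₚ.≟ x)) ⟩
    ∑ (allFin (size N)) (λ x → 𝟙 (act γ (tr σ x) Finₚ.≟ x))
      ≡⟨ fixCount-∑ γ σ ⟨
    fixCount F γ σ ∎
    where
    open ≡-Reasoning
    moved : ∀ x → tr τ (act γ (tr (conj τ σ) x)) ≡ act γ (tr σ (tr τ x))
    moved x = begin
      tr τ (act γ (tr (conj τ σ) x)) ≡⟨ act-tr γ τ _ ⟨
      act γ (tr τ (tr (conj τ σ) x)) ≡⟨ cong (act γ) (trans (sym (tr-∘ₚ τ (conj τ σ) x))
        (trans (cong (λ ρ → tr ρ x) (cancelˡ′ τ (σ ∘ₚ τ))) (tr-∘ₚ σ τ x))) ⟩
      act γ (tr σ (tr τ x))          ∎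

  -- A coloring sorted by τ is χ ∘ τ⁻¹, and σ preserves it iff τ⁻¹στ preserves χ.
  ∑-sorted-invariant : ∀ σ τ →
    ∑ (allVec k N) (λ c → 𝟙 (preserves? Finₚ._≟_ (lookup c) σ) * 𝟙 (sorts? τ c)) ≡ 𝟙 (stab? (conj τ σ))
  ∑-sorted-invariant σ τ = begin
    ∑ (allVec k N) (λ c → 𝟙 (preserves? Finₚ._≟_ (lookup c) σ) * 𝟙 (sorts? τ c))
      ≡⟨ ∑-cong (allVec k N) (λ c → trans (*-comm (𝟙 (preserves? Finₚ._≟_ (lookup c) σ)) _)
           (cong (_* 𝟙 (preserves? Finₚ._≟_ (lookup c) σ))
             (𝟙-⇔ (sorts? τ c) (c ≟ᵛ unsort)
               (λ s → lookup-ext (λ i → trans (cong (lookup c) (sym (inverseʳ τ i)))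
                 (trans (s (τ ⁻¹ ⟨$⟩ i)) (sym (lookup-unsort i)))))
               (λ { refl → sorted })))) ⟩
    ∑ (allVec k N) (λ c → 𝟙 (c ≟ᵛ unsort) * 𝟙 (preserves? Finₚ._≟_ (lookup c) σ))
      ≡⟨ Enum.∑-δ (vecEnum k N) unsort (λ c → 𝟙 (preserves? Finₚ._≟_ (lookup c) σ)) ⟩
    𝟙 (preserves? Finₚ._≟_ (lookup unsort) σ)
      ≡⟨ 𝟙-⇔ (preserves? Finₚ._≟_ (lookup unsort) σ) (stab? (conj τ σ))
           (λ p → preserves-χ⇐ (conj τ σ) (λ j → trans (sym (moved j)) (trans (p (τ ⟨$⟩ j)) (sorted j))))
           (λ p i → subst (λ i → lookup unsort (σ ⟨$⟩ i) ≡ lookup unsort i) (inverseʳ τ i)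
             (trans (moved (τ ⁻¹ ⟨$⟩ i))
               (trans (preserves-χ⇒ (conj τ σ) p (τ ⁻¹ ⟨$⟩ i)) (sym (sorted (τ ⁻¹ ⟨$⟩ i)))))) ⟩
    𝟙 (stab? (conj τ σ)) ∎
    where
    open ≡-Reasoning
    unsort : Vec (Fin k) N
    unsort = tabulate (λ i → χ (τ ⁻¹ ⟨$⟩ i))

    lookup-unsort : ∀ i → lookup unsort i ≡ χ (τ ⁻¹ ⟨$⟩ i)
    lookup-unsort = Vecₚ.lookup∘tabulate (λ i → χ (τ ⁻¹ ⟨$⟩ i))

    sorted : Sorts τ unsort
    sorted i = trans (lookup-unsort (τ ⟨$⟩ i)) (cong χ (inverseˡ τ i))

    moved : ∀ j → lookup unsort (σ ⟨$⟩ (τ ⟨$⟩ j)) ≡ χ (conj τ σ ⟨$⟩ j)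
    moved j = trans (cong (lookup unsort) (sym (conj-⟨$⟩ τ σ j))) (sorted (conj τ σ ⟨$⟩ j))

  -- Pairs of a `σ`-invariant coloring and a permutation sorting it are counted in two ways: by the
  -- coloring through `∑-sorts`, by the permutation through `∑-sorted-invariant`.
  invariantColorings-stab : ∀ σ →
    invariantColorings σ π * stabOrder ≡ ∑ (allPerms N) (λ τ → 𝟙 (stab? (conj τ σ)))
  invariantColorings-stab σ = begin
    invariantColorings σ π * stabOrder
      ≡⟨ ∑-*ʳ (allVec k N) stabOrder ⟨
    ∑ (allVec k N) (λ c → inv c * 𝟙 (content c ≟ᵉ π) * stabOrder)
      ≡⟨ ∑-cong (allVec k N) (λ c → trans (*-assoc (inv c) _ stabOrder)
           (trans (cong (inv c *_) (sym (∑-sorts c))) (sym (∑-*ˡ (allPerms N) (inv c))))) ⟩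
    ∑ (allVec k N) (λ c → ∑ (allPerms N) (λ τ → inv c * 𝟙 (sorts? τ c)))
      ≡⟨ ∑-swap (allVec k N) (allPerms N) ⟩
    ∑ (allPerms N) (λ τ → ∑ (allVec k N) (λ c → inv c * 𝟙 (sorts? τ c)))
      ≡⟨ ∑-cong (allPerms N) (∑-sorted-invariant σ) ⟩
    ∑ (allPerms N) (λ τ → 𝟙 (stab? (conj τ σ))) ∎
    where
    open ≡-Reasoning
    inv : Vec (Fin k) N → ℕ
    inv c = 𝟙 (preserves? Finₚ._≟_ (lookup c) σ)

  private
    weighted : Group.Carrier Γ → Perm N → ℕ
    weighted γ σ = 𝟙 (stab? σ) * fixCount F γ σ

  ∑-fix-invariant-stab : ∀ γ →
    ∑ (allPerms N) (λ σ → fixCount F γ σ * invariantColorings σ π) * stabOrder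
      ≡ N ! * ∑ (allPerms N) (weighted γ)
  ∑-fix-invariant-stab γ = begin
    ∑ (allPerms N) (λ σ → fixCount F γ σ * invariantColorings σ π) * stabOrder
      ≡⟨ ∑-*ʳ (allPerms N) stabOrder ⟨
    ∑ (allPerms N) (λ σ → fixCount F γ σ * invariantColorings σ π * stabOrder)
      ≡⟨ ∑-cong (allPerms N) (λ σ → trans (*-assoc (fixCount F γ σ) _ stabOrder)
           (trans (cong (fixCount F γ σ *_) (invariantColorings-stab σ))
             (trans (sym (∑-*ˡ (allPerms N) (fixCount F γ σ)))
               (∑-cong (allPerms N) (λ τ → trans (*-comm (fixCount F γ σ) (𝟙 (stab? (conj τ σ))))
                 (cong (𝟙 (stab? (conj τ σ)) *_) (sym (fixCount-conj γ τ σ)))))))) ⟩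
    ∑ (allPerms N) (λ σ → ∑ (allPerms N) (λ τ → weighted γ (conj τ σ)))
      ≡⟨ ∑-swap (allPerms N) (allPerms N) ⟩
    ∑ (allPerms N) (λ τ → ∑ (allPerms N) (λ σ → weighted γ (conj τ σ)))
      -- For fixed `τ`, conjugation permutes the group, so all the inner sums agree.
      ≡⟨ ∑-cong (allPerms N) (λ τ → ∑-conj τ (weighted γ)) ⟩
    ∑ (allPerms N) (λ _ → ∑ (allPerms N) (weighted γ))
      ≡⟨ ∑-const (allPerms N) _ ⟩
    ∑ (allPerms N) (λ _ → 1) * ∑ (allPerms N) (weighted γ)
      ≡⟨ cong (_* ∑ (allPerms N) (weighted γ)) (∑-perms N) ⟩
    N ! * ∑ (allPerms N) (weighted γ) ∎
    where open ≡-Reasoning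

  stabOrder≢0 : stabOrder ≢ 0
  stabOrder≢0 eq = 1+n≢0 (trans (sym (𝟙-yes (stab? idₚ) preserves-id))
    (Enum.∑≡0⇒ (permEnum N) (λ σ → 𝟙 (stab? σ)) eq idₚ))

  -- `burnside` produces the same factor `stabOrder` that was multiplied in on the left. It is
  -- positive because the identity preserves every coloring, so it cancels and no division is
  -- required.
  ∑-fix-invariant : ∀ γ →
    ∑ (allPerms N) (λ σ → fixCount F γ σ * invariantColorings σ π) ≡ N ! * numFixedPL F π γ
  ∑-fix-invariant γ = *-cancelʳ-≡ _ _ stabOrder {{≢-nonZero stabOrder≢0}} (begin
    ∑ (allPerms N) (λ σ → fixCount F γ σ * invariantColorings σ π) * stabOrder
      ≡⟨ ∑-fix-invariant-stab γ ⟩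
    N ! * ∑ (allPerms N) (weighted γ)
      ≡⟨ cong (N ! *_) (burnside γ) ⟩
    N ! * (numFixedPL F π γ * stabOrder)
      ≡⟨ *-assoc (N !) _ stabOrder ⟨
    N ! * numFixedPL F π γ * stabOrder ∎)
    where open ≡-Reasoning

-- Colorings constant on the classes of a partition

_+ᵉ_ : Vec ℕ k → Vec ℕ k → Vec ℕ k
_+ᵉ_ = Vec.zipWith _+_

single : ℕ → Fin k → Vec ℕ k
single m j = tabulate (λ i → if ⌊ i Finₚ.≟ j ⌋ then m else 0)

lookup-single : (m : ℕ) (j i : Fin k) → lookup (single m j) i ≡ 𝟙 (j Finₚ.≟ i) * m
lookup-single m j i = trans (Vecₚ.lookup∘tabulate _ i) (by-cases (i Finₚ.≟ j))
  where
  by-cases : (d : Dec (i ≡ j)) → (if ⌊ d ⌋ then m else 0) ≡ 𝟙 (j Finₚ.≟ i) * m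
  by-cases (yes eq) = sym (trans (cong (_* m) (𝟙-yes (j Finₚ.≟ i) (sym eq))) (*-identityˡ m))
  by-cases (no ne)  = sym (cong (_* m) (𝟙-no (j Finₚ.≟ i) (ne ∘ sym)))

-- The exponent vectors of the monomials of ∏ₘ (x₁ᵐ + ⋯ + x_kᵐ), m ∈ ms, with repetitions.
terms : List ℕ → List (Vec ℕ k)
terms []       = [ Vec.replicate _ 0 ]
terms (m ∷ ms) = concatMap (λ j → map (single m j +ᵉ_) (terms ms)) (allFin _)

∑-terms-∷ : ∀ m ms (φ : Vec ℕ k → ℕ) →
            ∑ (terms (m ∷ ms)) φ ≡ ∑ (allFin k) (λ j → ∑ (terms ms) (λ v → φ (single m j +ᵉ v)))
∑-terms-∷ {k} m ms φ = trans (∑-concatMap (λ j → map (single m j +ᵉ_) (terms ms)) (allFin k))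
  (∑-cong (allFin k) (λ j → ∑-map (single m j +ᵉ_) (terms ms)))

-- Weights make the recursion of `∑-constant` possible: a removed point that shares the color of
-- another one leaves its multiplicity there. Unit weights give back `content`.
wcontent : (Fin n → ℕ) → Vec (Fin k) n → Vec ℕ k
wcontent {n} w c = tabulate (λ j → ∑ (allFin n) (λ i → 𝟙 (lookup c i Finₚ.≟ j) * w i))

lookup-wcontent : (w : Fin n → ℕ) (c : Vec (Fin k) n) (j : Fin k) →
                  lookup (wcontent w c) j ≡ ∑ (allFin n) (λ i → 𝟙 (lookup c i Finₚ.≟ j) * w i)
lookup-wcontent w c = Vecₚ.lookup∘tabulate _

wcontent-∷ : (w : Fin (suc n) → ℕ) (a : Fin k) (c : Vec (Fin k) n) →
             wcontent w (a ∷ c) ≡ single (w zero) a +ᵉ wcontent (w ∘ suc) c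
wcontent-∷ {n} w a c = lookup-ext (λ j → begin
  lookup (wcontent w (a ∷ c)) j
    ≡⟨ lookup-wcontent w (a ∷ c) j ⟩
  ∑ (allFin (suc n)) (λ i → 𝟙 (lookup (a ∷ c) i Finₚ.≟ j) * w i)
    ≡⟨ ∑-allFin-suc n (λ i → 𝟙 (lookup (a ∷ c) i Finₚ.≟ j) * w i) ⟩
  𝟙 (a Finₚ.≟ j) * w zero + ∑ (allFin n) (λ i → 𝟙 (lookup c i Finₚ.≟ j) * w (suc i))
    ≡⟨ cong₂ _+_ (lookup-single (w zero) a j) (lookup-wcontent (w ∘ suc) c j) ⟨
  lookup (single (w zero) a) j + lookup (wcontent (w ∘ suc) c) j
    ≡⟨ Vecₚ.lookup-zipWith _+_ j (single (w zero) a) (wcontent (w ∘ suc) c) ⟨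
  lookup (single (w zero) a +ᵉ wcontent (w ∘ suc) c) j ∎)
  where open ≡-Reasoning

addAt : Fin n → ℕ → (Fin n → ℕ) → Fin n → ℕ
addAt r a w i = 𝟙 (i Finₚ.≟ r) * a + w i

∑-addAt : (r : Fin n) (a : ℕ) (w f : Fin n → ℕ) →
          ∑ (allFin n) (λ i → f i * addAt r a w i) ≡ f r * a + ∑ (allFin n) (λ i → f i * w i)
∑-addAt {n} r a w f = begin
  ∑ (allFin n) (λ i → f i * addAt r a w i)
    ≡⟨ ∑-cong (allFin n) (λ i → trans (*-distribˡ-+ (f i) (𝟙 (i Finₚ.≟ r) * a) (w i))
         (cong (_+ f i * w i) (*-exchange (f i) (𝟙 (i Finₚ.≟ r)) a))) ⟩
  ∑ (allFin n) (λ i → 𝟙 (i Finₚ.≟ r) * (f i * a) + f i * w i)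
    ≡⟨ ∑-+ (allFin n) ⟩
  ∑ (allFin n) (λ i → 𝟙 (i Finₚ.≟ r) * (f i * a)) + ∑ (allFin n) (λ i → f i * w i)
    ≡⟨ cong (_+ ∑ (allFin n) (λ i → f i * w i)) (Enum.∑-δ (finEnum n) r (λ i → f i * a)) ⟩
  f r * a + ∑ (allFin n) (λ i → f i * w i) ∎
  where
  open ≡-Reasoning

wcontent-addAt : (r : Fin n) (a : ℕ) (w : Fin n → ℕ) (c : Vec (Fin k) n) →
                 wcontent (addAt r a w) c ≡ single a (lookup c r) +ᵉ wcontent w c
wcontent-addAt {n} r a w c = lookup-ext (λ j → begin
  lookup (wcontent (addAt r a w) c) j
    ≡⟨ lookup-wcontent (addAt r a w) c j ⟩
  ∑ (allFin n) (λ i → 𝟙 (lookup c i Finₚ.≟ j) * addAt r a w i)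
    ≡⟨ ∑-addAt r a w (λ i → 𝟙 (lookup c i Finₚ.≟ j)) ⟩
  𝟙 (lookup c r Finₚ.≟ j) * a + ∑ (allFin n) (λ i → 𝟙 (lookup c i Finₚ.≟ j) * w i)
    ≡⟨ cong₂ _+_ (lookup-single a (lookup c r) j) (lookup-wcontent w c j) ⟨
  lookup (single a (lookup c r)) j + lookup (wcontent w c) j
    ≡⟨ Vecₚ.lookup-zipWith _+_ j (single a (lookup c r)) (wcontent w c) ⟨
  lookup (single a (lookup c r) +ᵉ wcontent w c) j ∎)
  where open ≡-Reasoning

rootList : (Fin n → Bool) → (Fin n → ℕ) → List ℕ
rootList {zero}  root W = []
rootList {suc n} root W = (if root zero then W zero ∷_ else id) (rootList (root ∘ suc) (W ∘ suc))

rootList-cong : {root root′ : Fin n → Bool} {W W′ : Fin n → ℕ} →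
                (∀ i → root i ≡ root′ i) → (∀ i → W i ≡ W′ i) → rootList root W ≡ rootList root′ W′
rootList-cong {zero}  eq eqW = refl
rootList-cong {suc n} eq eqW = cong₂ _$_
  (cong₂ (λ b m → if b then m ∷_ else id) (eq zero) (eqW zero))
  (rootList-cong (eq ∘ suc) (eqW ∘ suc))

⌊⌋-⇔ : (d : Dec P) (e : Dec Q) → (P → Q) → (Q → P) → ⌊ d ⌋ ≡ ⌊ e ⌋
⌊⌋-⇔ (yes p) (yes q) f g = refl
⌊⌋-⇔ (yes p) (no ¬q) f g = ⊥-elim (¬q (f p))
⌊⌋-⇔ (no ¬p) (yes q) f g = ⊥-elim (¬p (g q))
⌊⌋-⇔ (no ¬p) (no ¬q) f g = refl

isRoot : (Fin n → Fin n) → Fin n → Bool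
isRoot rep r = ⌊ rep r Finₚ.≟ r ⌋

weight : (Fin n → Fin n) → (Fin n → ℕ) → Fin n → ℕ
weight {n} rep w r = ∑ (allFin n) (λ i → 𝟙 (rep i Finₚ.≟ r) * w i)

Constant : (Fin n → Fin n) → Vec (Fin k) n → Set
Constant rep c = ∀ i → lookup c i ≡ lookup c (rep i)

constant? : (rep : Fin n → Fin n) (c : Vec (Fin k) n) → Dec (Constant rep c)
constant? rep c = Finₚ.all? (λ i → lookup c i Finₚ.≟ lookup c (rep i))

-- The default is never reached in `∑-constant`, where the second argument is `rep (suc i)` and is
-- therefore at least `suc i`.
predOr : Fin n → Fin (suc n) → Fin n
predOr d zero    = d
predOr d (suc r) = r

-- Point 0 is either a root, contributing an independent factor, or is glued to
-- its representative r, whose weight then absorbs that of 0.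
∑-constant : (rep : Fin n → Fin n) → (∀ i → i Fin.≤ rep i) → (∀ i → rep (rep i) ≡ rep i) →
             (w : Fin n → ℕ) (φ : Vec ℕ k → ℕ) →
             ∑ (allVec k n) (λ c → 𝟙 (constant? rep c) * φ (wcontent w c))
               ≡ ∑ (terms (rootList (isRoot rep) (weight rep w))) φ
∑-constant {zero}  {k} rep up idem w φ =
  cong (_+ 0) (trans (*-identityˡ _) (cong φ (lookup-ext {u = wcontent w []} {Vec.replicate k 0} (λ j →
    trans (lookup-wcontent {k = k} w [] j) (sym (Vecₚ.lookup-replicate j 0))))))
∑-constant {suc n} {k} rep up idem w φ = by-cases (rep zero) refl
  where
  open ≡-Reasoning

  -- Representatives lie above their points, so 0 can represent only itself. Removing it leaves all
  -- other points with their representatives.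
  rep′ : Fin n → Fin n
  rep′ i = predOr i (rep (suc i))

  suc-rep′ : ∀ i → suc (rep′ i) ≡ rep (suc i)
  suc-rep′ i = nonzero (rep (suc i)) (up (suc i))
    where
    nonzero : ∀ x → suc i Fin.≤ x → suc (predOr i x) ≡ x
    nonzero (suc _) _ = refl

  up′ : ∀ i → i Fin.≤ rep′ i
  up′ i = ≤-pred (subst (suc i Fin.≤_) (sym (suc-rep′ i)) (up (suc i)))

  idem′ : ∀ i → rep′ (rep′ i) ≡ rep′ i
  idem′ i = Finₚ.suc-injective (begin
    suc (rep′ (rep′ i))  ≡⟨ suc-rep′ (rep′ i) ⟩
    rep (suc (rep′ i))   ≡⟨ cong rep (suc-rep′ i) ⟩
    rep (rep (suc i))    ≡⟨ idem (suc i) ⟩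
    rep (suc i)          ≡⟨ suc-rep′ i ⟨
    suc (rep′ i)         ∎)

  root′ : ∀ i → isRoot rep (suc i) ≡ isRoot rep′ i
  root′ i = ⌊⌋-⇔ (rep (suc i) Finₚ.≟ suc i) (rep′ i Finₚ.≟ i)
    (λ eq → Finₚ.suc-injective (trans (suc-rep′ i) eq)) (λ eq → trans (sym (suc-rep′ i)) (cong suc eq))

  weight-suc : ∀ q → weight rep w (suc q) ≡ 𝟙 (rep zero Finₚ.≟ suc q) * w zero + weight rep′ (w ∘ suc) q
  weight-suc q = trans (∑-allFin-suc n (λ i → 𝟙 (rep i Finₚ.≟ suc q) * w i))
    (cong (𝟙 (rep zero Finₚ.≟ suc q) * w zero +_) (∑-cong (allFin n) (λ i → cong (_* w (suc i))
      (𝟙-⇔ (rep (suc i) Finₚ.≟ suc q) (rep′ i Finₚ.≟ q)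
        (λ eq → Finₚ.suc-injective (trans (suc-rep′ i) eq))
        (λ eq → trans (sym (suc-rep′ i)) (cong suc eq))))))

  constant-tail⇒ : ∀ a (c : Vec (Fin k) n) → Constant rep (a ∷ c) → Constant rep′ c
  constant-tail⇒ a c p i = trans (p (suc i)) (cong (lookup (a ∷ c)) (sym (suc-rep′ i)))

  constant-tail⇐ : ∀ a (c : Vec (Fin k) n) → Constant rep′ c → ∀ i → lookup c i ≡ lookup (a ∷ c) (rep (suc i))
  constant-tail⇐ a c p i = trans (p i) (cong (lookup (a ∷ c)) (suc-rep′ i))

  by-cases : ∀ z → rep zero ≡ z →
             ∑ (allVec k (suc n)) (λ c → 𝟙 (constant? rep c) * φ (wcontent w c))
               ≡ ∑ (terms (rootList (isRoot rep) (weight rep w))) φ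
  by-cases zero eq = begin
    ∑ (allVec k (suc n)) (λ c → 𝟙 (constant? rep c) * φ (wcontent w c))
      ≡⟨ ∑-allVec-suc k n ⟩
    ∑ (allFin k) (λ a → ∑ (allVec k n) (λ c → 𝟙 (constant? rep (a ∷ c)) * φ (wcontent w (a ∷ c))))
      ≡⟨ ∑-cong (allFin k) (λ a → ∑-cong (allVec k n) (λ c → cong₂ _*_
           (𝟙-⇔ (constant? rep (a ∷ c)) (constant? rep′ c) (constant-tail⇒ a c)
             (λ { p zero → cong (lookup (a ∷ c)) (sym eq) ; p (suc i) → constant-tail⇐ a c p i }))
           (cong φ (wcontent-∷ w a c)))) ⟩
    ∑ (allFin k) (λ a → ∑ (allVec k n) (λ c →
      𝟙 (constant? rep′ c) * φ (single (w zero) a +ᵉ wcontent (w ∘ suc) c)))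
      ≡⟨ ∑-cong (allFin k) (λ a → ∑-constant rep′ up′ idem′ (w ∘ suc) (λ v → φ (single (w zero) a +ᵉ v))) ⟩
    ∑ (allFin k) (λ a → ∑ (terms (rootList (isRoot rep′) (weight rep′ (w ∘ suc))))
      (λ v → φ (single (w zero) a +ᵉ v)))
      ≡⟨ ∑-terms-∷ (w zero) (rootList (isRoot rep′) (weight rep′ (w ∘ suc))) φ ⟨
    ∑ (terms (w zero ∷ rootList (isRoot rep′) (weight rep′ (w ∘ suc)))) φ
      ≡⟨ cong (λ l → ∑ (terms l) φ) (cong₂ _∷_ weight-zero (rootList-cong root′ weight-tail)) ⟨
    ∑ (terms (weight rep w zero ∷ rootList (isRoot rep ∘ suc) (weight rep w ∘ suc))) φ
      ≡⟨ cong (λ b → ∑ (terms ((if b then weight rep w zero ∷_ else id)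
           (rootList (isRoot rep ∘ suc) (weight rep w ∘ suc)))) φ) (root-zero (rep zero Finₚ.≟ zero)) ⟨
    ∑ (terms (rootList (isRoot rep) (weight rep w))) φ ∎
    where
    root-zero : (d : Dec (rep zero ≡ zero)) → ⌊ d ⌋ ≡ true
    root-zero (yes _) = refl
    root-zero (no ne) = ⊥-elim (ne eq)

    weight-zero : weight rep w zero ≡ w zero
    weight-zero = begin
      weight rep w zero
        ≡⟨ ∑-allFin-suc n (λ i → 𝟙 (rep i Finₚ.≟ zero) * w i) ⟩
      𝟙 (rep zero Finₚ.≟ zero) * w zero + ∑ (allFin n) (λ i → 𝟙 (rep (suc i) Finₚ.≟ zero) * w (suc i))
        ≡⟨ cong₂ _+_
             (trans (cong (_* w zero) (𝟙-yes (rep zero Finₚ.≟ zero) eq)) (*-identityˡ (w zero)))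
             (∑-zero (allFin n) (λ i → cong (_* w (suc i)) (𝟙-no (rep (suc i) Finₚ.≟ zero)
               (λ z → Finₚ.0≢1+n (trans (sym z) (sym (suc-rep′ i))))))) ⟩
      w zero + 0
        ≡⟨ +-identityʳ (w zero) ⟩
      w zero ∎

    weight-tail : ∀ q → weight rep w (suc q) ≡ weight rep′ (w ∘ suc) q
    weight-tail q = trans (weight-suc q) (cong (λ a → a * w zero + weight rep′ (w ∘ suc) q)
      (𝟙-no (rep zero Finₚ.≟ suc q) (λ s → Finₚ.0≢1+n (trans (sym eq) s))))

  by-cases (suc r) eq = begin
    ∑ (allVec k (suc n)) (λ c → 𝟙 (constant? rep c) * φ (wcontent w c))
      ≡⟨ ∑-allVec-suc k n ⟩
    ∑ (allFin k) (λ a → ∑ (allVec k n) (λ c → 𝟙 (constant? rep (a ∷ c)) * φ (wcontent w (a ∷ c))))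
      ≡⟨ ∑-swap (allFin k) (allVec k n) ⟩
    ∑ (allVec k n) (λ c → ∑ (allFin k) (λ a → 𝟙 (constant? rep (a ∷ c)) * φ (wcontent w (a ∷ c))))
      -- The color of point 0 is forced to be that of its representative, so the sum over `a` will
      -- collapse to one term.
      ≡⟨ ∑-cong (allVec k n) (λ c → ∑-cong (allFin k) (λ a → trans
           (cong (_* φ (wcontent w (a ∷ c))) (trans
             (𝟙-⇔ (constant? rep (a ∷ c)) ((a Finₚ.≟ lookup c r) ×-dec constant? rep′ c)
               (λ p → trans (p zero) (cong (lookup (a ∷ c)) eq) , constant-tail⇒ a c p)
               (λ { (q , p) zero → trans q (cong (lookup (a ∷ c)) (sym eq))
                  ; (q , p) (suc i) → constant-tail⇐ a c p i }))
             (𝟙-× (a Finₚ.≟ lookup c r) (constant? rep′ c))))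
           (*-assoc (𝟙 (a Finₚ.≟ lookup c r)) (𝟙 (constant? rep′ c)) _))) ⟩
    ∑ (allVec k n) (λ c → ∑ (allFin k) (λ a →
      𝟙 (a Finₚ.≟ lookup c r) * (𝟙 (constant? rep′ c) * φ (wcontent w (a ∷ c)))))
      ≡⟨ ∑-cong (allVec k n) (λ c → Enum.∑-δ (finEnum k) (lookup c r)
           (λ a → 𝟙 (constant? rep′ c) * φ (wcontent w (a ∷ c)))) ⟩
    ∑ (allVec k n) (λ c → 𝟙 (constant? rep′ c) * φ (wcontent w (lookup c r ∷ c)))
      ≡⟨ ∑-cong (allVec k n) (λ c → cong (λ v → 𝟙 (constant? rep′ c) * φ v)
           (trans (wcontent-∷ w (lookup c r) c) (sym (wcontent-addAt r (w zero) (w ∘ suc) c)))) ⟩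
    ∑ (allVec k n) (λ c → 𝟙 (constant? rep′ c) * φ (wcontent w′ c))
      ≡⟨ ∑-constant rep′ up′ idem′ w′ φ ⟩
    ∑ (terms (rootList (isRoot rep′) (weight rep′ w′))) φ
      ≡⟨ cong (λ l → ∑ (terms l) φ) (rootList-cong root′ weight-tail) ⟨
    ∑ (terms (rootList (isRoot rep ∘ suc) (weight rep w ∘ suc))) φ
      ≡⟨ cong (λ b → ∑ (terms ((if b then weight rep w zero ∷_ else id)
           (rootList (isRoot rep ∘ suc) (weight rep w ∘ suc)))) φ) (root-zero (rep zero Finₚ.≟ zero)) ⟨
    ∑ (terms (rootList (isRoot rep) (weight rep w))) φ ∎
    where
    w′ : Fin n → ℕ
    w′ = addAt r (w zero) (w ∘ suc)

    root-zero : (d : Dec (rep zero ≡ zero)) → ⌊ d ⌋ ≡ false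
    root-zero (yes z) = ⊥-elim (Finₚ.0≢1+n (trans (sym z) eq))
    root-zero (no _)  = refl

    -- Idempotence makes `r` a root of the smaller structure, so the weight moved to `r` counts
    -- towards the class that contained 0.
    rep′-r : rep′ r ≡ r
    rep′-r = Finₚ.suc-injective (trans (suc-rep′ r)
      (trans (cong rep (sym eq)) (trans (idem zero) eq)))

    weight-tail : ∀ q → weight rep w (suc q) ≡ weight rep′ w′ q
    weight-tail q = begin
      weight rep w (suc q)
        ≡⟨ weight-suc q ⟩
      𝟙 (rep zero Finₚ.≟ suc q) * w zero + weight rep′ (w ∘ suc) q
        ≡⟨ cong (λ a → a * w zero + weight rep′ (w ∘ suc) q)
             (𝟙-⇔ (rep zero Finₚ.≟ suc q) (rep′ r Finₚ.≟ q)
               (λ s → trans rep′-r (Finₚ.suc-injective (trans (sym eq) s)))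
               (λ s → trans eq (cong suc (trans (sym rep′-r) s)))) ⟩
      𝟙 (rep′ r Finₚ.≟ q) * w zero + weight rep′ (w ∘ suc) q
        ≡⟨ ∑-addAt r (w zero) (w ∘ suc) (λ i → 𝟙 (rep′ i Finₚ.≟ q)) ⟨
      weight rep′ w′ q ∎

-- Cycles

iter-multiple : (σ : Perm n) {L : ℕ} {i : Fin n} → iter σ L i ≡ i → ∀ q → iter σ (q * L) i ≡ i
iter-multiple σ     ret zero    = refl
iter-multiple σ {L} ret (suc q) = trans (iter-+ σ L (q * L) _) (trans (cong (iter σ L) (iter-multiple σ ret q)) ret)

iter-% : (σ : Perm n) (L : ℕ) .{{_ : NonZero L}} {i : Fin n} → iter σ L i ≡ i →
         ∀ t → iter σ t i ≡ iter σ (t % L) i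
iter-% σ L {i} ret t = begin
  iter σ t i                                ≡⟨ cong (λ s → iter σ s i) (m≡m%n+[m/n]*n t L) ⟩
  iter σ (t % L + t / L * L) i              ≡⟨ iter-+ σ (t % L) (t / L * L) i ⟩
  iter σ (t % L) (iter σ (t / L * L) i)     ≡⟨ cong (iter σ (t % L)) (iter-multiple σ ret (t / L)) ⟩
  iter σ (t % L) i                          ∎
  where open ≡-Reasoning

Reaches : Perm n → Fin n → Fin n → Set
Reaches σ i j = ∃ λ t → iter σ t i ≡ j

-- Reducing a time modulo a return time of `i`, which is at most `n`, shows that times below `n`
-- suffice.
reaches? : (σ : Perm n) (i j : Fin n) → Dec (Reaches σ i j)
reaches? {n} σ i j = map′ (λ { (t , eq) → toℕ t , eq }) bound (Finₚ.any? (λ t → iter σ (toℕ t) i Finₚ.≟ j))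
  where
  bound : Reaches σ i j → ∃ λ (t : Fin n) → iter σ (toℕ t) i ≡ j
  bound (t , eq) with returns σ i
  ... | p , p<n , ret = Fin.fromℕ< t%<n ,
    trans (cong (λ s → iter σ s i) (Finₚ.toℕ-fromℕ< t%<n)) (trans (sym (iter-% σ (suc p) ret t)) eq)
    where
    t%<n : t % suc p < n
    t%<n = <-≤-trans (m%n<n t (suc p)) p<n

reaches-trans : (σ : Perm n) {i j l : Fin n} → Reaches σ i j → Reaches σ j l → Reaches σ i l
reaches-trans σ (s , refl) (t , refl) = t + s , iter-+ σ t s _

-- If `i` returns after `p + 1` steps, then `t * p` further steps complete the `t` already made to
-- `t` full periods.
reaches-sym : (σ : Perm n) {i j : Fin n} → Reaches σ i j → Reaches σ j i
reaches-sym σ {i} (t , refl) with returns σ i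
... | p , _ , ret = t * p , (begin
  iter σ (t * p) (iter σ t i)  ≡⟨ iter-+ σ (t * p) t i ⟨
  iter σ (t * p + t) i         ≡⟨ cong (λ s → iter σ s i) (trans (+-comm (t * p) t) (sym (*-suc t p))) ⟩
  iter σ (t * suc p) i         ≡⟨ iter-multiple σ ret t ⟩
  i                            ∎)
  where open ≡-Reasoning

-- The greatest element of the cycle is chosen, not the least, because `∑-constant` removes points
-- from below and requires `i ≤ rep i`.
rep : Perm n → Fin n → Fin n
rep σ i = proj₁ (greatest (reaches? σ i) (i , 0 , refl))

rep-reaches : (σ : Perm n) (i : Fin n) → Reaches σ i (rep σ i)
rep-reaches σ i = proj₁ (proj₂ (greatest (reaches? σ i) (i , 0 , refl)))

rep-max : (σ : Perm n) (i : Fin n) {l : Fin n} → Reaches σ i l → l Fin.≤ rep σ i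
rep-max σ i = proj₂ (proj₂ (greatest (reaches? σ i) (i , 0 , refl))) _

rep-cong : (σ : Perm n) {i j : Fin n} → Reaches σ i j → rep σ i ≡ rep σ j
rep-cong σ {i} {j} r = Finₚ.≤-antisym
  (rep-max σ j (reaches-trans σ (reaches-sym σ r) (rep-reaches σ i)))
  (rep-max σ i (reaches-trans σ r (rep-reaches σ j)))

rep≡⇒reaches : (σ : Perm n) {i j : Fin n} → rep σ i ≡ rep σ j → Reaches σ i j
rep≡⇒reaches σ {i} {j} eq =
  reaches-trans σ (subst (Reaches σ i) eq (rep-reaches σ i)) (reaches-sym σ (rep-reaches σ j))

rep-up : (σ : Perm n) (i : Fin n) → i Fin.≤ rep σ i
rep-up σ i = rep-max σ i (0 , refl)

rep-idem : (σ : Perm n) (i : Fin n) → rep σ (rep σ i) ≡ rep σ i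
rep-idem σ i = sym (rep-cong σ (rep-reaches σ i))

preserves-iter : (σ : Perm n) (c : Fin n → A) → Preserves c σ → ∀ t i → c (iter σ t i) ≡ c i
preserves-iter σ c p zero    i = refl
preserves-iter σ c p (suc t) i = trans (p (iter σ t i)) (preserves-iter σ c p t i)

preserves⇒constant : (σ : Perm n) (c : Vec (Fin k) n) → Preserves (lookup c) σ → Constant (rep σ) c
preserves⇒constant σ c p i with rep-reaches σ i
... | t , eq = trans (sym (preserves-iter σ (lookup c) p t i)) (cong (lookup c) eq)

constant⇒preserves : (σ : Perm n) (c : Vec (Fin k) n) → Constant (rep σ) c → Preserves (lookup c) σ
constant⇒preserves σ c p j =
  trans (p (σ ⟨$⟩ j)) (trans (cong (lookup c) (sym (rep-cong σ (1 , refl)))) (sym (p j)))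

-- First return times and cycle lengths

firstReturn : (σ : Perm n) (i : Fin n) → ℕ → ℕ → Fin n → ℕ
firstReturn σ i zero    m x = m
firstReturn σ i (suc f) m x = if ⌊ x Finₚ.≟ i ⌋ then m else firstReturn σ i f (suc m) (σ ⟨$⟩ x)

-- firstReturn copies the local loop of cycleLength, which has no name outside Defs.
-- The underscore in the type of loop≡firstReturn stands for that loop: it is solved by
-- the call in cycleLength-firstReturn, where with-abstraction has turned all arguments
-- of the loop into distinct variables. The family S keeps Perm from being unfolded.
mutual
  cycleLength-firstReturn : (S : ℕ → Set) (perm : ∀ w → S w → Perm w) →
    ∀ n (s : S (suc n)) (i : Fin (suc n)) →
    cycleLength (perm _ s) i ≡ firstReturn (perm _ s) i (suc n) 1 (perm _ s ⟨$⟩ i)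
  cycleLength-firstReturn S perm n s i with perm _ s ⟨$⟩ i Finₚ.≟ i
  ... | yes _ = refl
  ... | no _ with perm _ s ⟨$⟩ (perm _ s ⟨$⟩ i) | 2
  ...   | x | m with suc n | s | i | x
  ...     | w | s′ | i′ | x′ = loop≡firstReturn S perm w s′ i′ n m x′

  loop≡firstReturn : (S : ℕ → Set) (perm : ∀ w → S w → Perm w) →
    ∀ w (s : S w) (i : Fin w) (f m : ℕ) (x : Fin w) → _ ≡ firstReturn (perm _ s) i f m x
  loop≡firstReturn S perm w s i zero    m x = refl
  loop≡firstReturn S perm w s i (suc f) m x with x Finₚ.≟ i
  ... | yes _ = refl
  ... | no _  = loop≡firstReturn S perm w s i f (suc m) (perm _ s ⟨$⟩ x)

NoReturn : Perm n → Fin n → ℕ → Set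
NoReturn σ i m = ∀ t → 1 ≤ t → t < m → iter σ t i ≢ i

FirstReturn : Perm n → Fin n → ℕ → Set
FirstReturn σ i m = 1 ≤ m × iter σ m i ≡ i × NoReturn σ i m

-- Invariant of the loop: nothing has returned before time `m`, and some return lies within the
-- remaining fuel. Once the fuel is spent, the promised time can only be `m`, so the default result
-- is correct as well.
firstReturn-spec : (σ : Perm n) (i : Fin n) → ∀ f m → 1 ≤ m → NoReturn σ i m →
                   (∃ λ L → m ≤ L × L ≤ m + f × iter σ L i ≡ i) →
                   FirstReturn σ i (firstReturn σ i f m (iter σ m i))
firstReturn-spec σ i zero m 1≤m none (L , m≤L , L≤m , ret) =
  1≤m , subst (λ t → iter σ t i ≡ i) (≤-antisym (subst (L ≤_) (+-identityʳ m) L≤m) m≤L) ret , none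
firstReturn-spec σ i (suc f) m 1≤m none (L , m≤L , L≤ , ret) with iter σ m i Finₚ.≟ i
... | yes now = 1≤m , now , none
... | no ¬now = firstReturn-spec σ i f (suc m) (m≤n⇒m≤1+n 1≤m) none′
  (L , ≤∧≢⇒< m≤L (λ { refl → ¬now ret }) , subst (L ≤_) (+-suc m f) L≤ , ret)
  where
  none′ : NoReturn σ i (suc m)
  none′ t 1≤t t<1+m with m≤n⇒m<n∨m≡n (s≤s⁻¹ t<1+m)
  ... | inj₁ t<m  = none t 1≤t t<m
  ... | inj₂ refl = ¬now

cycleLength-spec : (σ : Perm n) (i : Fin n) → FirstReturn σ i (cycleLength σ i)
cycleLength-spec {suc n} σ i = subst (FirstReturn σ i)
  (sym (cycleLength-firstReturn Perm (λ _ → id) n σ i))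
  (firstReturn-spec σ i (suc n) 1 ≤-refl (λ t 1≤t t<1 → ⊥-elim (<⇒≱ t<1 1≤t))
    (let p , p<n , ret = returns σ i in suc p , s≤s z≤n , m≤n⇒m≤1+n p<n , ret))

-- Equal iterates at different times would yield a return after their difference, a positive time
-- below `L`.
firstReturn-distinct : (σ : Perm n) (i : Fin n) {L : ℕ} → NoReturn σ i L →
                       ∀ {s t} → s < L → t < L → iter σ s i ≡ iter σ t i → s ≡ t
firstReturn-distinct σ i {L} none {s} {t} s<L t<L eq with <-cmp s t
... | tri≈ _ s≡t _ = s≡t
... | tri< s<t _ _ = ⊥-elim (none (t ∸ s) (m<n⇒0<n∸m s<t) (≤-<-trans (m∸n≤m t s) t<L)
                       (iter-cancel σ (<⇒≤ s<t) eq))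
... | tri> _ _ t<s = ⊥-elim (none (s ∸ t) (m<n⇒0<n∸m t<s) (≤-<-trans (m∸n≤m s t) s<L)
                       (iter-cancel σ (<⇒≤ t<s) (sym eq)))

orbitSize : Perm n → Fin n → ℕ
orbitSize σ = weight (rep σ) (λ _ → 1)

-- The times 0 to `L - 1` visit each point of the cycle exactly once and no other point; counting
-- pairs of a time and the point visited gives both numbers.
orbitSize-firstReturn : (σ : Perm n) (i : Fin n) {L : ℕ} → FirstReturn σ i L → L ≡ orbitSize σ (rep σ i)
orbitSize-firstReturn {n} σ i {suc p} (_ , ret , none) = begin
  suc p
    ≡⟨ ∑-allFin-1 (suc p) ⟨
  ∑ (allFin (suc p)) (λ _ → 1)
    ≡⟨ ∑-cong (allFin (suc p)) (λ t → trans
         (∑-cong (allFin n) (λ j → 𝟙-⇔ (iter σ (toℕ t) i Finₚ.≟ j) (j Finₚ.≟ iter σ (toℕ t) i) sym sym))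
         (Enum.once (finEnum n) (iter σ (toℕ t) i))) ⟨
  ∑ (allFin (suc p)) (λ t → ∑ (allFin n) (λ j → 𝟙 (iter σ (toℕ t) i Finₚ.≟ j)))
    ≡⟨ ∑-swap (allFin (suc p)) (allFin n) ⟩
  ∑ (allFin n) (λ j → ∑ (allFin (suc p)) (λ t → 𝟙 (iter σ (toℕ t) i Finₚ.≟ j)))
    ≡⟨ ∑-cong (allFin n) (λ j → trans (visits j (rep σ j Finₚ.≟ rep σ i)) (sym (*-identityʳ _))) ⟩
  orbitSize σ (rep σ i) ∎
  where
  open ≡-Reasoning
  visits : ∀ j (d : Dec (rep σ j ≡ rep σ i)) →
           ∑ (allFin (suc p)) (λ t → 𝟙 (iter σ (toℕ t) i Finₚ.≟ j)) ≡ 𝟙 d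
  visits j (no ne)  = ∑-zero (allFin (suc p)) (λ t → 𝟙-no (iter σ (toℕ t) i Finₚ.≟ j)
    (λ eq → ne (sym (rep-cong σ (toℕ t , eq)))))
  visits j (yes eq) with rep≡⇒reaches σ (sym eq)
  ... | t₁ , reach = trans
    (∑-cong (allFin (suc p)) (λ t → 𝟙-⇔ (iter σ (toℕ t) i Finₚ.≟ j) (t Finₚ.≟ t₀)
      (λ eq → Finₚ.toℕ-injective (firstReturn-distinct σ i none (Finₚ.toℕ<n t) (Finₚ.toℕ<n t₀)
        (trans eq (sym at-t₀))))
      (λ { refl → at-t₀ })))
    (Enum.once (finEnum (suc p)) t₀)
    where
    t₀ : Fin (suc p)
    t₀ = Fin.fromℕ< (m%n<n t₁ (suc p))

    at-t₀ : iter σ (toℕ t₀) i ≡ j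
    at-t₀ = trans (cong (λ s → iter σ s i) (Finₚ.toℕ-fromℕ< (m%n<n t₁ (suc p))))
      (trans (sym (iter-% σ (suc p) ret t₁)) reach)

cycleLength-orbitSize : (σ : Perm n) (i : Fin n) → cycleLength σ i ≡ orbitSize σ (rep σ i)
cycleLength-orbitSize σ i = orbitSize-firstReturn σ i (cycleLength-spec σ i)

-- One length per cycle, in the order of the greatest elements of the cycles.
cycleType : Perm n → List ℕ
cycleType σ = rootList (isRoot (rep σ)) (orbitSize σ)

∑-rootList : (root : Fin n → Bool) (W : Fin n → ℕ) (f : ℕ → ℕ) →
             ∑ (rootList root W) f ≡ ∑ (allFin n) (λ r → 𝟙 (T-dec (root r)) * f (W r))
∑-rootList {zero}  root W f = refl
∑-rootList {suc n} root W f = trans (head (root zero))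
  (trans (cong (𝟙 (T-dec (root zero)) * f (W zero) +_) (∑-rootList (root ∘ suc) (W ∘ suc) f))
    (sym (∑-allFin-suc n (λ r → 𝟙 (T-dec (root r)) * f (W r)))))
  where
  rest : List ℕ
  rest = rootList (root ∘ suc) (W ∘ suc)
  head : ∀ b → ∑ ((if b then W zero ∷_ else id) rest) f ≡ 𝟙 (T-dec b) * f (W zero) + ∑ rest f
  head true  = cong (_+ ∑ rest f) (sym (*-identityˡ (f (W zero))))
  head false = refl

occ : ℕ → List ℕ → ℕ
occ a xs = ∑ xs (λ x → 𝟙 (x ℕₚ.≟ a))

orbitSize-nonroot : (σ : Perm n) (r : Fin n) → rep σ r ≢ r → orbitSize σ r ≡ 0
orbitSize-nonroot {n} σ r ne = ∑-zero (allFin n) (λ i → cong (_* 1) (𝟙-no (rep σ i Finₚ.≟ r)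
  (λ { refl → ne (rep-idem σ i) })))

-- Each cycle of length `suc m` accounts for `suc m` of the points counted, so the division in
-- `numCycles` is exact.
numCycles-occ : (σ : Perm n) (m : ℕ) → numCycles σ (suc m) ≡ occ (suc m) (cycleType σ)
numCycles-occ {n} σ m = trans (cong (_/ suc m) (begin
  count (λ i → ⌊ cycleLength σ i ℕₚ.≟ suc m ⌋) (allFin n)
    ≡⟨ count-∑ _ (allFin n) ⟩
  ∑ (allFin n) (λ i → 𝟙 (T-dec ⌊ cycleLength σ i ℕₚ.≟ suc m ⌋))
    ≡⟨ ∑-cong (allFin n) (λ i → trans (𝟙-T-⌊⌋ (cycleLength σ i ℕₚ.≟ suc m))
         (trans (cong (λ l → 𝟙 (l ℕₚ.≟ suc m)) (cycleLength-orbitSize σ i))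
           (sym (Enum.∑-δ (finEnum n) (rep σ i) (λ r → 𝟙 (W r ℕₚ.≟ suc m)))))) ⟩
  ∑ (allFin n) (λ i → ∑ (allFin n) (λ r → 𝟙 (r Finₚ.≟ rep σ i) * 𝟙 (W r ℕₚ.≟ suc m)))
    ≡⟨ ∑-swap (allFin n) (allFin n) ⟩
  ∑ (allFin n) (λ r → ∑ (allFin n) (λ i → 𝟙 (r Finₚ.≟ rep σ i) * 𝟙 (W r ℕₚ.≟ suc m)))
    ≡⟨ ∑-cong (allFin n) (λ r → trans (∑-*ʳ (allFin n) (𝟙 (W r ℕₚ.≟ suc m)))
         (trans (cong (_* 𝟙 (W r ℕₚ.≟ suc m)) (∑-cong (allFin n) (λ i → trans
           (𝟙-⇔ (r Finₚ.≟ rep σ i) (rep σ i Finₚ.≟ r) sym sym) (sym (*-identityʳ _)))))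
           (per-root r))) ⟩
  ∑ (allFin n) (λ r → 𝟙 (T-dec (isRoot (rep σ) r)) * 𝟙 (W r ℕₚ.≟ suc m) * suc m)
    ≡⟨ ∑-*ʳ (allFin n) (suc m) ⟩
  ∑ (allFin n) (λ r → 𝟙 (T-dec (isRoot (rep σ) r)) * 𝟙 (W r ℕₚ.≟ suc m)) * suc m
    ≡⟨ cong (_* suc m) (∑-rootList (isRoot (rep σ)) W (λ x → 𝟙 (x ℕₚ.≟ suc m))) ⟨
  occ (suc m) (cycleType σ) * suc m ∎)) (m*n/n≡m (occ (suc m) (cycleType σ)) (suc m))
  where
  open ≡-Reasoning
  W : Fin n → ℕ
  W = orbitSize σ

  per-root : ∀ r → W r * 𝟙 (W r ℕₚ.≟ suc m) ≡ 𝟙 (T-dec (isRoot (rep σ) r)) * 𝟙 (W r ℕₚ.≟ suc m) * suc m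
  per-root r = begin
    W r * 𝟙 (W r ℕₚ.≟ suc m)
      ≡⟨ *-comm (W r) _ ⟩
    𝟙 (W r ℕₚ.≟ suc m) * W r
      ≡⟨ 𝟙-guard (W r ℕₚ.≟ suc m) id ⟩
    𝟙 (W r ℕₚ.≟ suc m) * suc m
      -- A point that is not a root represents nothing, so its class has size 0, which is never
      -- `suc m`; the root indicator can be inserted freely.
      ≡⟨ cong (_* suc m) (𝟙-absorb (T-dec (isRoot (rep σ) r)) (λ ¬root → 𝟙-no (W r ℕₚ.≟ suc m)
           (λ eq → 1+n≢0 (trans (sym eq) (orbitSize-nonroot σ r (¬root ∘ fromWitness)))))) ⟨
    𝟙 (T-dec (isRoot (rep σ) r)) * 𝟙 (W r ℕₚ.≟ suc m) * suc m ∎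

orbitSize≤n : (σ : Perm n) (r : Fin n) → orbitSize σ r ≤ n
orbitSize≤n {n} σ r = subst (orbitSize σ r ≤_) (∑-allFin-1 n)
  (go (allFin n))
  where
  bound : ∀ {P : Set} (d : Dec P) → 𝟙 d * 1 ≤ 1
  bound (yes _) = ≤-refl
  bound (no _)  = z≤n
  go : ∀ xs → ∑ xs (λ i → 𝟙 (rep σ i Finₚ.≟ r) * 1) ≤ ∑ xs (λ _ → 1)
  go []       = z≤n
  go (x ∷ xs) = +-mono-≤ (bound (rep σ x Finₚ.≟ r)) (go xs)

-- Together with `cycleType-≤n` this ensures that the lengths 1 to `n` over which `pσ` ranges miss
-- no cycle.
cycleType-pos : (σ : Perm n) → occ 0 (cycleType σ) ≡ 0
cycleType-pos {n} σ = trans (∑-rootList (isRoot (rep σ)) (orbitSize σ) (λ x → 𝟙 (x ℕₚ.≟ 0)))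
  (∑-zero (allFin n) (λ r → 𝟙-vanish (T-dec (isRoot (rep σ) r)) (λ root →
    𝟙-no (orbitSize σ r ℕₚ.≟ 0) (λ eq → 1+n≢0 (trans (sym (cong (_* 1) (𝟙-yes (rep σ r Finₚ.≟ r) (toWitness root))))
      (Enum.∑≡0⇒ (finEnum n) (λ i → 𝟙 (rep σ i Finₚ.≟ r) * 1) eq r))))))

cycleType-≤n : (σ : Perm n) (a : ℕ) → n < a → occ a (cycleType σ) ≡ 0
cycleType-≤n {n} σ a n<a = trans (∑-rootList (isRoot (rep σ)) (orbitSize σ) (λ x → 𝟙 (x ℕₚ.≟ a)))
  (∑-zero (allFin n) (λ r → 𝟙-vanish (T-dec (isRoot (rep σ) r)) (λ _ →
    𝟙-no (orbitSize σ r ℕₚ.≟ a) (λ { refl → <⇒≱ n<a (orbitSize≤n σ r) }))))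

-- Invariance under `σ` means being constant on its cycles, so `∑-constant` applies with unit
-- weights: a cycle of length m receives one color j and contributes the term `x_j^m` of a power
-- sum.
invariantColorings-terms : (σ : Perm n) (α : Vec ℕ k) →
                           invariantColorings σ α ≡ ∑ (terms (cycleType σ)) (λ v → 𝟙 (v ≟ᵉ α))
invariantColorings-terms {n} {k} σ α = trans
  (∑-cong (allVec k n) (λ c → cong₂ _*_
    (𝟙-⇔ (preserves? Finₚ._≟_ (lookup c) σ) (constant? (rep σ) c)
      (preserves⇒constant σ c) (constant⇒preserves σ c))
    (cong (λ v → 𝟙 (v ≟ᵉ α)) (Vecₚ.tabulate-cong (λ j → ∑-cong (allFin n) (λ i → sym (*-identityʳ _)))))))
  (∑-constant (rep σ) (rep-up σ) (rep-idem σ) (λ _ → 1) (λ v → 𝟙 (v ≟ᵉ α)))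

-- Coefficients of power-sum products

∑-upTo-suc : ∀ n (f : ℕ → ℕ) → ∑ (upTo (suc n)) f ≡ f 0 + ∑ (upTo n) (f ∘ suc)
∑-upTo-suc n f = cong (λ xs → f 0 + xs)
  (trans (cong (λ l → ∑ l f) (sym (Listₚ.map-upTo suc n))) (∑-map suc (upTo n)))

∑-upTo-δ : ∀ n x (f : ℕ → ℕ) → ∑ (upTo n) (λ b → 𝟙 (x ℕₚ.≟ b) * f b) ≡ 𝟙 (x ℕₚ.<? n) * f x
∑-upTo-δ zero    x       f = sym (cong (_* f x) (𝟙-no (x ℕₚ.<? 0) (λ ())))
∑-upTo-δ (suc n) zero    f = trans (∑-upTo-suc n (λ b → 𝟙 (0 ℕₚ.≟ b) * f b))
  (trans (cong (1 * f 0 +_) (∑-zero (upTo n) (λ b → cong (_* f (suc b)) (𝟙-no (0 ℕₚ.≟ suc b) (λ ())))))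
    (trans (+-identityʳ _) (cong (_* f 0) (sym (𝟙-yes (0 ℕₚ.<? suc n) (s≤s z≤n))))))
∑-upTo-δ (suc n) (suc x) f = trans (∑-upTo-suc n (λ b → 𝟙 (suc x ℕₚ.≟ b) * f b))
  (trans (∑-cong (upTo n) (λ b → cong (_* f (suc b)) (𝟙-⇔ (suc x ℕₚ.≟ suc b) (x ℕₚ.≟ b) suc-injective (cong suc))))
    (trans (∑-upTo-δ n x (f ∘ suc)) (cong (_* f (suc x))
      (𝟙-⇔ (x ℕₚ.<? n) (suc x ℕₚ.<? suc n) s≤s ≤-pred))))

occ-self : ∀ x xs → occ x (x ∷ xs) ≢ 0
occ-self x xs eq = 1+n≢0 (trans (sym (cong (_+ occ x xs) (𝟙-yes (x ℕₚ.≟ x) refl))) eq)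

occ⇒∈ : ∀ x ys → occ x ys ≢ 0 → x ∈ ys
occ⇒∈ x []       ne = ⊥-elim (ne refl)
occ⇒∈ x (y ∷ ys) ne with y ℕₚ.≟ x
... | yes refl = here refl
... | no y≢x   = there (occ⇒∈ x ys (λ eq → ne (cong₂ _+_ (𝟙-no (y ℕₚ.≟ x) y≢x) eq)))

-- This allows cycle lengths listed by length to be exchanged for those listed by representative.
occ⇒↭ : ∀ xs ys → (∀ a → occ a xs ≡ occ a ys) → xs ↭ ys
occ⇒↭ []       []       eq = ↭-refl
occ⇒↭ []       (y ∷ ys) eq = ⊥-elim (occ-self y ys (sym (eq y)))
occ⇒↭ (x ∷ xs) ys       eq with ∈-∃++ (occ⇒∈ x ys (λ z → occ-self x xs (trans (eq x) z)))
... | as , bs , refl = ↭-trans (prep x (occ⇒↭ xs (as ++ bs) (λ a → +-cancelˡ-≡ (𝟙 (x ℕₚ.≟ a)) _ _ (begin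
  𝟙 (x ℕₚ.≟ a) + occ a xs                 ≡⟨ eq a ⟩
  occ a (as ++ x ∷ bs)                    ≡⟨ ∑-++ as (x ∷ bs) ⟩
  occ a as + (𝟙 (x ℕₚ.≟ a) + occ a bs)    ≡⟨ x∙yz≈y∙xz (occ a as) (𝟙 (x ℕₚ.≟ a)) (occ a bs) ⟩
  𝟙 (x ℕₚ.≟ a) + (occ a as + occ a bs)    ≡⟨ cong (𝟙 (x ℕₚ.≟ a) +_) (∑-++ as bs) ⟨
  𝟙 (x ℕₚ.≟ a) + occ a (as ++ bs)         ∎)))) (↭-sym (shift x as bs))
  where open ≡-Reasoning

+ᵉ-comm : (u v : Vec ℕ k) → u +ᵉ v ≡ v +ᵉ u
+ᵉ-comm = Vecₚ.zipWith-comm +-comm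

+ᵉ-assoc : (u v w : Vec ℕ k) → (u +ᵉ v) +ᵉ w ≡ u +ᵉ (v +ᵉ w)
+ᵉ-assoc = Vecₚ.zipWith-assoc +-assoc

+ᵉ-identityˡ : (v : Vec ℕ k) → Vec.replicate k 0 +ᵉ v ≡ v
+ᵉ-identityˡ = Vecₚ.zipWith-identityˡ +-identityˡ

-- Commutativity of the product of power sums. Testing against an arbitrary `φ` avoids permuting the
-- expanded lists of exponent vectors, and shifting `φ` by a factor is what lets the induction pass
-- under a leading power sum.
terms-↭ : {ms ms′ : List ℕ} → ms ↭ ms′ → (φ : Vec ℕ k → ℕ) → ∑ (terms ms) φ ≡ ∑ (terms ms′) φ
terms-↭ ↭.refl φ = refl
terms-↭ {k} (↭.prep {ms} {ms′} m p) φ = begin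
  ∑ (terms (m ∷ ms)) φ                                              ≡⟨ ∑-terms-∷ m ms φ ⟩
  ∑ (allFin k) (λ j → ∑ (terms ms) (λ v → φ (single m j +ᵉ v)))     ≡⟨ ∑-cong (allFin k) (λ j → terms-↭ p _) ⟩
  ∑ (allFin k) (λ j → ∑ (terms ms′) (λ v → φ (single m j +ᵉ v)))    ≡⟨ ∑-terms-∷ m ms′ φ ⟨
  ∑ (terms (m ∷ ms′)) φ                                             ∎
  where open ≡-Reasoning
terms-↭ {k} (↭.swap {ms} {ms′} a b p) φ = begin
  ∑ (terms (a ∷ b ∷ ms)) φ
    ≡⟨ expand a b ms ⟩
  ∑ (allFin k) (λ i → ∑ (allFin k) (λ j → ∑ (terms ms) (λ v → φ (single a i +ᵉ (single b j +ᵉ v)))))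
    ≡⟨ ∑-swap (allFin k) (allFin k) ⟩
  ∑ (allFin k) (λ j → ∑ (allFin k) (λ i → ∑ (terms ms) (λ v → φ (single a i +ᵉ (single b j +ᵉ v)))))
    ≡⟨ ∑-cong (allFin k) (λ j → ∑-cong (allFin k) (λ i → trans
         (∑-cong (terms ms) (λ v → cong φ (exchange (single a i) (single b j) v))) (terms-↭ p _))) ⟩
  ∑ (allFin k) (λ j → ∑ (allFin k) (λ i → ∑ (terms ms′) (λ v → φ (single b j +ᵉ (single a i +ᵉ v)))))
    ≡⟨ expand b a ms′ ⟨
  ∑ (terms (b ∷ a ∷ ms′)) φ ∎
  where
  open ≡-Reasoning
  expand : ∀ a b ms → ∑ (terms (a ∷ b ∷ ms)) φ ≡
    ∑ (allFin k) (λ i → ∑ (allFin k) (λ j → ∑ (terms ms) (λ v → φ (single a i +ᵉ (single b j +ᵉ v)))))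
  expand a b ms = trans (∑-terms-∷ a (b ∷ ms) φ)
    (∑-cong (allFin k) (λ i → ∑-terms-∷ b ms (λ v → φ (single a i +ᵉ v))))

  exchange : ∀ u v w → u +ᵉ (v +ᵉ w) ≡ v +ᵉ (u +ᵉ w)
  exchange u v w = trans (sym (+ᵉ-assoc u v w)) (trans (cong (_+ᵉ w) (+ᵉ-comm u v)) (+ᵉ-assoc v u w))
terms-↭ (↭.trans p q) φ = trans (terms-↭ p φ) (terms-↭ q φ)

terms-++ : ∀ ms ms′ (φ : Vec ℕ k → ℕ) →
           ∑ (terms (ms ++ ms′)) φ ≡ ∑ (terms ms) (λ u → ∑ (terms ms′) (λ v → φ (u +ᵉ v)))
terms-++ {k} [] ms′ φ = trans (∑-cong (terms ms′) (λ v → cong φ (sym (+ᵉ-identityˡ v)))) (sym (+-identityʳ _))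
terms-++ {k} (m ∷ ms) ms′ φ = begin
  ∑ (terms (m ∷ ms ++ ms′)) φ
    ≡⟨ ∑-terms-∷ m (ms ++ ms′) φ ⟩
  ∑ (allFin k) (λ j → ∑ (terms (ms ++ ms′)) (λ v → φ (single m j +ᵉ v)))
    ≡⟨ ∑-cong (allFin k) (λ j → trans (terms-++ ms ms′ (λ v → φ (single m j +ᵉ v)))
         (∑-cong (terms ms) (λ u → ∑-cong (terms ms′) (λ v → cong φ (sym (+ᵉ-assoc (single m j) u v)))))) ⟩
  ∑ (allFin k) (λ j → ∑ (terms ms) (λ u → ∑ (terms ms′) (λ v → φ ((single m j +ᵉ u) +ᵉ v))))
    ≡⟨ ∑-terms-∷ m ms (λ u → ∑ (terms ms′) (λ v → φ (u +ᵉ v))) ⟨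
  ∑ (terms (m ∷ ms)) (λ u → ∑ (terms ms′) (λ v → φ (u +ᵉ v))) ∎
  where open ≡-Reasoning

-- The naturals inside the rationals

toℚ-mkℚ : ∀ m → toℚ m ≡ mkℚ (ℤ.+ m) 0 (Coprimality.sym (Coprimality.1-coprimeTo m))
toℚ-mkℚ m = ℚₚ.normalize-coprime (Coprimality.sym (Coprimality.1-coprimeTo m))

-- Once both summands are written with the explicit denominator 1, rational addition unfolds to a
-- single integer sum over 1.
toℚ-+ : ∀ a b → toℚ (a + b) ≡ toℚ a ℚ.+ toℚ b
toℚ-+ a b = sym (trans (cong₂ ℚ._+_ (toℚ-mkℚ a) (toℚ-mkℚ b))
  (cong (ℚ._/ 1) (cong₂ ℤ._+_ (ℤₚ.*-identityʳ (ℤ.+ a)) (ℤₚ.*-identityʳ (ℤ.+ b)))))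

toℚ-* : ∀ a b → toℚ (a * b) ≡ toℚ a ℚ.* toℚ b
toℚ-* a b = sym (trans (cong₂ ℚ._*_ (toℚ-mkℚ a) (toℚ-mkℚ b))
  (cong (ℚ._/ 1) (sym (ℤₚ.pos-* a b))))

-- Normalisation by a gcd does not compute for a variable `d`, so the product is evaluated among
-- unnormalised fractions.
1/d*d : ∀ d .{{_ : NonZero d}} → (ℤ.+ 1 ℚ./ d) ℚ.* toℚ d ≡ 1ℚ
1/d*d (suc d) = ℚₚ.toℚᵘ-injective (begin
  ℚ.toℚᵘ ((ℤ.+ 1 ℚ./ suc d) ℚ.* toℚ (suc d))
    ≈⟨ ℚₚ.toℚᵘ-homo-* (ℤ.+ 1 ℚ./ suc d) (toℚ (suc d)) ⟩
  ℚ.toℚᵘ (ℤ.+ 1 ℚ./ suc d) ℚᵘ.* ℚ.toℚᵘ (toℚ (suc d))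
    ≈⟨ ℚᵘₚ.*-cong (ℚₚ.toℚᵘ-fromℚᵘ (ℚᵘ.mkℚᵘ (ℤ.+ 1) d)) (ℚₚ.toℚᵘ-fromℚᵘ (ℚᵘ.mkℚᵘ (ℤ.+ suc d) 0)) ⟩
  ℚᵘ.mkℚᵘ (ℤ.+ 1) d ℚᵘ.* ℚᵘ.mkℚᵘ (ℤ.+ suc d) 0
    ≈⟨ ℚᵘₚ.*-inverseˡ (ℚᵘ.mkℚᵘ (ℤ.+ suc d) 0) ⟩
  ℚᵘ.1ℚᵘ ∎)
  where open ℚᵘₚ.≃-Reasoning

1/d*[d*x] : ∀ d .{{_ : NonZero d}} x → (ℤ.+ 1 ℚ./ d) ℚ.* toℚ (d * x) ≡ toℚ x
1/d*[d*x] d x = begin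
  (ℤ.+ 1 ℚ./ d) ℚ.* toℚ (d * x)             ≡⟨ cong ((ℤ.+ 1 ℚ./ d) ℚ.*_) (toℚ-* d x) ⟩
  (ℤ.+ 1 ℚ./ d) ℚ.* (toℚ d ℚ.* toℚ x)       ≡⟨ ℚₚ.*-assoc (ℤ.+ 1 ℚ./ d) (toℚ d) (toℚ x) ⟨
  (ℤ.+ 1 ℚ./ d) ℚ.* toℚ d ℚ.* toℚ x         ≡⟨ cong (ℚ._* toℚ x) (1/d*d d) ⟩
  1ℚ ℚ.* toℚ x                            ≡⟨ ℚₚ.*-identityˡ (toℚ x) ⟩
  toℚ x                                   ∎
  where open ≡-Reasoning

sumℚ-toℚ : (xs : List A) {g : A → ℚ} {f : A → ℕ} → (∀ x → g x ≡ toℚ (f x)) →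
           sumℚ (map g xs) ≡ toℚ (∑ xs f)
sumℚ-toℚ []           eq = refl
sumℚ-toℚ (x ∷ xs) {f = f} eq = trans (cong₂ ℚ._+_ (eq x) (sumℚ-toℚ xs eq)) (sym (toℚ-+ (f x) (∑ xs f)))

sumP-toℚ : (xs : List A) {g : A → Poly k} {f : A → ℕ} (α : Vec ℕ k) → (∀ x → g x α ≡ toℚ (f x)) →
           sumP (map g xs) α ≡ toℚ (∑ xs f)
sumP-toℚ []       α eq = refl
sumP-toℚ (x ∷ xs) {f = f} α eq = trans (cong₂ ℚ._+_ (eq x) (sumP-toℚ xs α eq)) (sym (toℚ-+ (f x) (∑ xs f)))

-- Monomials, Cauchy products and cycle monomials

𝟙-∷ : ∀ x y (u v : Vec ℕ k) → 𝟙 ((x ∷ u) ≟ᵉ (y ∷ v)) ≡ 𝟙 (x ℕₚ.≟ y) * 𝟙 (u ≟ᵉ v)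
𝟙-∷ x y u v = trans
  (𝟙-⇔ ((x ∷ u) ≟ᵉ (y ∷ v)) ((x ℕₚ.≟ y) ×-dec (u ≟ᵉ v)) Vecₚ.∷-injective (λ { (refl , refl) → refl }))
  (𝟙-× (x ℕₚ.≟ y) (u ≟ᵉ v))

mono-toℚ : (β α : Vec ℕ k) → mono β α ≡ toℚ (𝟙 (β ≟ᵉ α))
mono-toℚ β α = trans (bool (α ≡ᵛ β)) (cong toℚ (test β α))
  where
  bool : ∀ b → (if b then 1ℚ else 0ℚ) ≡ toℚ (𝟙 (T-dec b))
  bool true  = refl
  bool false = refl

  test : ∀ {k} (β α : Vec ℕ k) → 𝟙 (T-dec (α ≡ᵛ β)) ≡ 𝟙 (β ≟ᵉ α)
  test []      []      = refl
  test (b ∷ β) (a ∷ α) = begin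
    𝟙 (T-dec (⌊ a ℕₚ.≟ b ⌋ ∧ (α ≡ᵛ β)))
      ≡⟨ 𝟙-⇔ (T-dec (⌊ a ℕₚ.≟ b ⌋ ∧ (α ≡ᵛ β))) (T-dec ⌊ a ℕₚ.≟ b ⌋ ×-dec T-dec (α ≡ᵛ β))
           T-∧⁻ (λ { (p , q) → T-∧⁺ p q }) ⟩
    𝟙 (T-dec ⌊ a ℕₚ.≟ b ⌋ ×-dec T-dec (α ≡ᵛ β))
      ≡⟨ 𝟙-× (T-dec ⌊ a ℕₚ.≟ b ⌋) (T-dec (α ≡ᵛ β)) ⟩
    𝟙 (T-dec ⌊ a ℕₚ.≟ b ⌋) * 𝟙 (T-dec (α ≡ᵛ β))
      ≡⟨ cong₂ _*_ (trans (𝟙-T-⌊⌋ (a ℕₚ.≟ b)) (𝟙-⇔ (a ℕₚ.≟ b) (b ℕₚ.≟ a) sym sym)) (test β α) ⟩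
    𝟙 (b ℕₚ.≟ a) * 𝟙 (β ≟ᵉ α)
      ≡⟨ 𝟙-∷ b a β α ⟨
    𝟙 ((b ∷ β) ≟ᵉ (a ∷ α)) ∎
    where open ≡-Reasoning

-- Only `b = x` can contribute, and only if `x ≤ a`; in that range the truncated subtraction is a
-- true difference.
∑-splittings : ∀ a x y → ∑ (upTo (suc a)) (λ b → 𝟙 (x ℕₚ.≟ b) * 𝟙 (y ℕₚ.≟ a ∸ b)) ≡ 𝟙 (x + y ℕₚ.≟ a)
∑-splittings a x y = trans (∑-upTo-δ (suc a) x (λ b → 𝟙 (y ℕₚ.≟ a ∸ b))) (trans
  (sym (𝟙-× (x ℕₚ.<? suc a) (y ℕₚ.≟ a ∸ x)))
  (𝟙-⇔ ((x ℕₚ.<? suc a) ×-dec (y ℕₚ.≟ a ∸ x)) (x + y ℕₚ.≟ a)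
    (λ { (x<1+a , refl) → m+[n∸m]≡n (≤-pred x<1+a) })
    (λ { refl → s≤s (m≤m+n x y) , sym (m+n∸m≡n x y) })))

-- This is the rule `x^u · x^v = x^(u+v)` for the Cauchy product `⊗`, obtained one variable at a
-- time.
∑-below : (α u v : Vec ℕ k) →
          ∑ (below α) (λ β → 𝟙 (u ≟ᵉ β) * 𝟙 (v ≟ᵉ (α ∸ᵛ β))) ≡ 𝟙 ((u +ᵉ v) ≟ᵉ α)
∑-below []      []      []      = refl
∑-below (a ∷ α) (x ∷ u) (y ∷ v) = begin
  ∑ (below (a ∷ α)) (λ β → 𝟙 ((x ∷ u) ≟ᵉ β) * 𝟙 ((y ∷ v) ≟ᵉ ((a ∷ α) ∸ᵛ β)))
    ≡⟨ ∑-concatMap (λ b → map (b ∷_) (below α)) (upTo (suc a)) ⟩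
  ∑ (upTo (suc a)) (λ b → ∑ (map (b ∷_) (below α))
    (λ β → 𝟙 ((x ∷ u) ≟ᵉ β) * 𝟙 ((y ∷ v) ≟ᵉ ((a ∷ α) ∸ᵛ β))))
    ≡⟨ ∑-cong (upTo (suc a)) (λ b → trans (∑-map (b ∷_) (below α)) (trans
         (∑-cong (below α) (λ β → trans
           (cong₂ _*_ (𝟙-∷ x b u β) (𝟙-∷ y (a ∸ b) v (α ∸ᵛ β)))
           (*-interchange (𝟙 (x ℕₚ.≟ b)) (𝟙 (u ≟ᵉ β)) (𝟙 (y ℕₚ.≟ a ∸ b)) (𝟙 (v ≟ᵉ (α ∸ᵛ β))))))
         (trans (∑-*ˡ (below α) (𝟙 (x ℕₚ.≟ b) * 𝟙 (y ℕₚ.≟ a ∸ b)))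
           (cong (𝟙 (x ℕₚ.≟ b) * 𝟙 (y ℕₚ.≟ a ∸ b) *_) (∑-below α u v))))) ⟩
  ∑ (upTo (suc a)) (λ b → 𝟙 (x ℕₚ.≟ b) * 𝟙 (y ℕₚ.≟ a ∸ b) * 𝟙 ((u +ᵉ v) ≟ᵉ α))
    ≡⟨ ∑-*ʳ (upTo (suc a)) (𝟙 ((u +ᵉ v) ≟ᵉ α)) {λ b → 𝟙 (x ℕₚ.≟ b) * 𝟙 (y ℕₚ.≟ a ∸ b)} ⟩
  ∑ (upTo (suc a)) (λ b → 𝟙 (x ℕₚ.≟ b) * 𝟙 (y ℕₚ.≟ a ∸ b)) * 𝟙 ((u +ᵉ v) ≟ᵉ α)
    ≡⟨ cong (_* 𝟙 ((u +ᵉ v) ≟ᵉ α)) (∑-splittings a x y) ⟩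
  𝟙 (x + y ℕₚ.≟ a) * 𝟙 ((u +ᵉ v) ≟ᵉ α)
    ≡⟨ 𝟙-∷ (x + y) a (u +ᵉ v) α ⟨
  𝟙 (((x ∷ u) +ᵉ (y ∷ v)) ≟ᵉ (a ∷ α)) ∎
  where open ≡-Reasoning

coeff : List ℕ → Vec ℕ k → ℕ
coeff ms α = ∑ (terms ms) (λ v → 𝟙 (v ≟ᵉ α))

-- Says that `f` is the product of the power sums of degrees `ms`, with rational coefficients
-- replaced by counts of exponent vectors. It is propagated along the construction of `pσ`.
Represents : List ℕ → Poly k → Set
Represents ms f = ∀ α → f α ≡ toℚ (coeff ms α)

represents-one : Represents {k} [] oneP
represents-one {k} α = trans (mono-toℚ (Vec.replicate k 0) α) (cong toℚ (sym (+-identityʳ (𝟙 (Vec.replicate k 0 ≟ᵉ α)))))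

represents-powerSum : ∀ m → Represents {k} (m ∷ []) (powerSum k m)
represents-powerSum {k} m α = trans
  (sumP-toℚ (allFin k) α (λ j → mono-toℚ (single m j) α))
  (cong toℚ (sym (trans (∑-terms-∷ m [] (λ v → 𝟙 (v ≟ᵉ α)))
    (∑-cong (allFin k) (λ j → trans (+-identityʳ _)
      (cong (λ v → 𝟙 (v ≟ᵉ α)) (trans (+ᵉ-comm (single m j) _) (+ᵉ-identityˡ (single m j)))))))))

represents-⊗ : ∀ ms ms′ {f g : Poly k} → Represents ms f → Represents ms′ g → Represents (ms ++ ms′) (f ⊗ g)
represents-⊗ {k} ms ms′ {f} {g} rf rg α = trans
  (sumℚ-toℚ (below α) (λ β → trans (cong₂ ℚ._*_ (rf β) (rg (α ∸ᵛ β))) (sym (toℚ-* (coeff ms β) (coeff ms′ (α ∸ᵛ β))))))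
  (cong toℚ (begin
  ∑ (below α) (λ β → coeff ms β * coeff ms′ (α ∸ᵛ β))
    ≡⟨ ∑-cong (below α) (λ β → trans (sym (∑-*ʳ (terms ms) (coeff ms′ (α ∸ᵛ β))))
         (∑-cong (terms ms) (λ u → sym (∑-*ˡ (terms ms′) (𝟙 (u ≟ᵉ β)))))) ⟩
  ∑ (below α) (λ β → ∑ (terms ms) (λ u → ∑ (terms ms′) (λ v → 𝟙 (u ≟ᵉ β) * 𝟙 (v ≟ᵉ (α ∸ᵛ β)))))
    ≡⟨ ∑-swap (below α) (terms ms) ⟩
  ∑ (terms ms) (λ u → ∑ (below α) (λ β → ∑ (terms ms′) (λ v → 𝟙 (u ≟ᵉ β) * 𝟙 (v ≟ᵉ (α ∸ᵛ β)))))
    ≡⟨ ∑-cong (terms ms) (λ u → trans (∑-swap (below α) (terms ms′))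
         (∑-cong (terms ms′) (λ v → ∑-below α u v))) ⟩
  ∑ (terms ms) (λ u → ∑ (terms ms′) (λ v → 𝟙 ((u +ᵉ v) ≟ᵉ α)))
    ≡⟨ terms-++ ms ms′ (λ v → 𝟙 (v ≟ᵉ α)) ⟨
  coeff (ms ++ ms′) α ∎))
  where open ≡-Reasoning

represents-^ : ∀ m e → Represents {k} (replicate e m) (powerSum k m ^P e)
represents-^ m zero    = represents-one
represents-^ m (suc e) = represents-⊗ (m ∷ []) (replicate e m) (represents-powerSum m) (represents-^ m e)

represents-foldr : (e : ℕ → ℕ) (ls : List ℕ) →
  Represents {k} (concatMap (λ m → replicate (e m) m) ls)
    (List.foldr (λ m f → (powerSum k m ^P e m) ⊗ f) oneP ls)
represents-foldr e []       = represents-one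
represents-foldr e (m ∷ ls) = represents-⊗ (replicate (e m) m) _ (represents-^ m (e m)) (represents-foldr e ls)

∑-replicate : ∀ e (x : A) (f : A → ℕ) → ∑ (replicate e x) f ≡ e * f x
∑-replicate zero    x f = refl
∑-replicate (suc e) x f = cong (f x +_) (∑-replicate e x f)

-- The cycle lengths in the order in which the factors of `pσ` present them.
cyclesByLength : Perm n → List ℕ
cyclesByLength {n} σ = concatMap (λ m → replicate (numCycles σ m) m) (map suc (upTo n))

occ-cyclesByLength : (σ : Perm n) (a : ℕ) → occ a (cyclesByLength σ) ≡ occ a (cycleType σ)
occ-cyclesByLength {n} σ a = trans expand (by-cases a)
  where
  expand : occ a (cyclesByLength σ) ≡ ∑ (upTo n) (λ b → occ (suc b) (cycleType σ) * 𝟙 (suc b ℕₚ.≟ a))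
  expand = trans (∑-concatMap (λ m → replicate (numCycles σ m) m) (map suc (upTo n)))
    (trans (∑-map suc (upTo n)) (∑-cong (upTo n) (λ b → trans
      (∑-replicate (numCycles σ (suc b)) (suc b) (λ x → 𝟙 (x ℕₚ.≟ a)))
      (cong (_* 𝟙 (suc b ℕₚ.≟ a)) (numCycles-occ σ b)))))

  by-cases : ∀ a → ∑ (upTo n) (λ b → occ (suc b) (cycleType σ) * 𝟙 (suc b ℕₚ.≟ a)) ≡ occ a (cycleType σ)
  by-cases zero    = trans (∑-zero (upTo n) (λ b → trans
    (cong (occ (suc b) (cycleType σ) *_) (𝟙-no (suc b ℕₚ.≟ 0) (λ ()))) (*-zeroʳ (occ (suc b) (cycleType σ)))))
    (sym (cycleType-pos σ))
  by-cases (suc a) = trans (∑-cong (upTo n) (λ b → trans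
    (*-comm (occ (suc b) (cycleType σ)) _)
    (cong (_* occ (suc b) (cycleType σ))
      (𝟙-⇔ (suc b ℕₚ.≟ suc a) (a ℕₚ.≟ b) (sym ∘ suc-injective) (cong suc ∘ sym)))))
    (trans (∑-upTo-δ n a (λ b → occ (suc b) (cycleType σ)))
      -- Lengths above `n` lie outside the range of the sum, and no cycle has such a length.
      (𝟙-absorb (a ℕₚ.<? n) (λ a≮n → cycleType-≤n σ (suc a) (s≤s (≮⇒≥ a≮n)))))

pσ-invariantColorings : (σ : Perm n) (α : Vec ℕ k) → pσ k σ α ≡ toℚ (invariantColorings σ α)
pσ-invariantColorings {n} σ α = trans (represents-foldr (numCycles σ) (map suc (upTo n)) α)
  (cong toℚ (trans
    (terms-↭ (occ⇒↭ (cyclesByLength σ) (cycleType σ) (occ-cyclesByLength σ)) (λ v → 𝟙 (v ≟ᵉ α)))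
    (sym (invariantColorings-terms σ α))))

-- Homogeneity and the coefficient of the full series

sum-lookup : (α : Vec ℕ k) → Vec.sum α ≡ ∑ (allFin k) (lookup α)
sum-lookup []              = refl
sum-lookup {suc k} (a ∷ α) = trans (cong (λ s → a + s) (sum-lookup α)) (sym (∑-allFin-suc k (lookup (a ∷ α))))

sum-content : (c : Vec (Fin k) n) → Vec.sum (content c) ≡ n
sum-content {k} {n} c = begin
  Vec.sum (content c)                                             ≡⟨ sum-lookup (content c) ⟩
  ∑ (allFin k) (lookup (content c))                               ≡⟨ ∑-cong (allFin k) (Vecₚ.lookup∘tabulate (fibre (lookup c))) ⟩
  ∑ (allFin k) (λ j → ∑ (allFin n) (λ i → 𝟙 (lookup c i Finₚ.≟ j))) ≡⟨ ∑-swap (allFin k) (allFin n) ⟩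
  ∑ (allFin n) (λ i → ∑ (allFin k) (λ j → 𝟙 (lookup c i Finₚ.≟ j))) ≡⟨ ∑-cong (allFin n) (λ i → trans
    (∑-cong (allFin k) (λ j → 𝟙-⇔ (lookup c i Finₚ.≟ j) (j Finₚ.≟ lookup c i) sym sym))
    (Enum.once (finEnum k) (lookup c i))) ⟩
  ∑ (allFin n) (λ _ → 1)                                          ≡⟨ ∑-allFin-1 n ⟩
  n                                                               ∎
  where open ≡-Reasoning

-- Every point has exactly one color, so contents have total `n`. In terms of symmetric functions,
-- `p_σ` is homogeneous of degree `n`.
invariantColorings-degree : (σ : Perm n) (α : Vec ℕ k) → n ≢ Vec.sum α → invariantColorings σ α ≡ 0
invariantColorings-degree {n} {k} σ α ne = ∑-zero (allVec k n) (λ c → 𝟙-vanish (preserves? Finₚ._≟_ (lookup c) σ)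
  (λ _ → 𝟙-no (content c ≟ᵉ α) (λ { refl → ne (sym (sum-content c)) })))

sumℚ-last : ∀ n (h : ℕ → ℚ) → (∀ m → m < n → h m ≡ 0ℚ) → sumℚ (applyUpTo h (suc n)) ≡ h n
sumℚ-last zero    h z = ℚₚ.+-identityʳ (h 0)
sumℚ-last (suc n) h z = trans (cong₂ ℚ._+_ (z 0 (s≤s z≤n)) (sumℚ-last n (h ∘ suc) (λ m m<n → z (suc m) (s≤s m<n))))
  (ℚₚ.+-identityˡ (h (suc n)))

module _ {c ℓ : Level} {Γ : Group c ℓ} (F : ΓSpecies Γ) where

  ηZdeg-∑ : ∀ k γ N (α : Vec ℕ k) → ηZdeg F k γ N α ≡
    ((ℤ.+ 1 ℚ./ (N !)) {{N !≢0}}) ℚ.* toℚ (∑ (allPerms N) (λ σ → fixCount F γ σ * invariantColorings σ α))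
  ηZdeg-∑ k γ N α = cong (((ℤ.+ 1 ℚ./ (N !)) {{N !≢0}}) ℚ.*_)
    (sumP-toℚ (allPerms N) α (λ σ → trans (cong (toℚ (fixCount F γ σ) ℚ.*_) (pσ-invariantColorings σ α))
      (sym (toℚ-* (fixCount F γ σ) (invariantColorings σ α)))))

theorem2p3 : {c ℓ : Level} (Γ : Group c ℓ) (F : ΓSpecies Γ)
    (k : ℕ) (π : Vec ℕ k) → (∀ i → 1 ≤ lookup π i) →
    (γ : Group.Carrier Γ) →
    toℚ (numFixedPL F π γ) ≡ coeffηZ F γ π
theorem2p3 Γ F k π _ γ = sym (begin
  coeffηZ F γ π
    ≡⟨ cong sumℚ (Listₚ.map-upTo (λ N → ηZdeg F k γ N π) (suc deg)) ⟩
  sumℚ (applyUpTo (λ N → ηZdeg F k γ N π) (suc deg))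
    -- The sum stops at degree `deg`, and a permutation of fewer points has no coloring with content
    -- `π`, so only the last term survives.
    ≡⟨ sumℚ-last deg (λ N → ηZdeg F k γ N π) lower ⟩
  ηZdeg F k γ deg π
    ≡⟨ ηZdeg-∑ F k γ deg π ⟩
  ((ℤ.+ 1 ℚ./ (deg !)) {{deg !≢0}}) ℚ.* toℚ (∑ (allPerms deg) (λ σ → fixCount F γ σ * invariantColorings σ π))
    ≡⟨ cong (λ x → ((ℤ.+ 1 ℚ./ (deg !)) {{deg !≢0}}) ℚ.* toℚ x) (Conjugation.∑-fix-invariant F π γ) ⟩
  ((ℤ.+ 1 ℚ./ (deg !)) {{deg !≢0}}) ℚ.* toℚ (deg ! * numFixedPL F π γ)
    ≡⟨ 1/d*[d*x] (deg !) {{deg !≢0}} (numFixedPL F π γ) ⟩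
  toℚ (numFixedPL F π γ) ∎)
  where
  open ≡-Reasoning
  deg : ℕ
  deg = Vec.sum π

  lower : ∀ N → N < deg → ηZdeg F k γ N π ≡ 0ℚ
  lower N N<deg = trans (ηZdeg-∑ F k γ N π) (trans
    (cong (λ x → ((ℤ.+ 1 ℚ./ (N !)) {{N !≢0}}) ℚ.* toℚ x) (∑-zero (allPerms N) (λ σ → trans
      (cong (fixCount F γ σ *_) (invariantColorings-degree σ π (<⇒≢ N<deg))) (*-zeroʳ (fixCount F γ σ)))))
    (ℚₚ.*-zeroʳ ((ℤ.+ 1 ℚ./ (N !)) {{N !≢0}})))
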